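{- Let $F$ be a Ferrers shape, let $n\ge 0$ be an integer and let $s,t$ be positive integers. Let $N(F;n;\mathit{NE}=s,\mathit{SE}=t)$ denote the number of $0$-$1$-fillings of $F$ with exactly $n$ entries equal to $1$ such that every row and every column of $F$ contains at most one $1$, the longest NE-chain has length $s$, and the longest SE-chain (among SE-chains whose smallest enclosing rectangle is contained in $F$) has length $t$. Then $$N(F;n;\mathit{NE}=s,\mathit{SE}=t)=N(F;n;\mathit{NE}=t,\mathit{SE}=s).$$
   Context: A Ferrers shape (in French notation) is a finite set of unit cells arranged in columns $1,\dots,m$ from left to right and rows numbered from the bottom, where column $j$ consists of the cells in rows $1,\dots,h_j$ and $h_1\ge h_2\ge\dots\ge h_m\ge 1$ (so it has a straight left side, a straight bottom side, and the columns weakly decrease in height from left to right). A $0$-$1$-filling assigns $0$ or $1$ to every cell. An NE-chain is a sequence of cells containing $1$ such that each cell in the sequence lies strictly above and strictly to the right of the preceding one; an SE-chain is a sequence of cells containing $1$ such that each lies strictly below and strictly to the right of the preceding one. The length of a chain is the number of its cells. The smallest rectangle containing a chain is the set of cells whose column lies between the columns of the first and last cells and whose row lies between the rows of the first and last cells; for SE-chains only those whose smallest rectangle lies entirely in $F$ are considered (for NE-chains this holds automatically). -}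

module Defs where

open import Data.Nat using (ℕ; zero; suc; _+_; _≤_; _<_)
open import Data.Bool using (Bool; true; false; if_then_else_)
open import Data.List using (List; []; _∷_; length; last)
open import Data.List.Relation.Unary.All using (All)
open import Data.List.Relation.Unary.Linked using (Linked)
open import Data.List.Relation.Unary.Sorted.TotalOrder using (Sorted)
open import Data.List.Relation.Unary.Unique.Propositional using (Unique)
open import Data.List.Membership.Propositional using (_∈_)
open import Data.Vec using (Vec; []; _∷_)
open import Data.Product using (_×_; _,_; proj₁; proj₂; ∃)
open import Data.Unit using (⊤)
open import Function.Bundles using (_⇔_)
open import Relation.Binary.PropositionalEquality using (_≡_)
import Data.Nat.Properties as ℕP
import Relation.Binary.Construct.Flip.EqAndOrd as Flip

-- Shapes.  A shape is the list of column heights h₁, h₂, …, hₘ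
-- (columns from left to right).  Columns and rows are 0-based here:
-- cell (c , r) is column c+1, row r+1 of the paper.

Shape : Set
Shape = List ℕ

IsFerrers : Shape → Set
IsFerrers hs = Sorted (Flip.totalOrder ℕP.≤-totalOrder) hs × All (1 ≤_) hs

height : Shape → ℕ → ℕ
height []       _       = 0
height (h ∷ hs) zero    = h
height (h ∷ hs) (suc c) = height hs c

Cell : Set
Cell = ℕ × ℕ

col row : Cell → ℕ
col = proj₁
row = proj₂

_∈F_ : Cell → Shape → Set
(c , r) ∈F hs = c < length hs × r < height hs c

data Filling : Shape → Set where
  []  : Filling []
  _∷_ : ∀ {h hs} → Vec Bool h → Filling hs → Filling (h ∷ hs)

entryV : ∀ {h} → Vec Bool h → ℕ → Bool
entryV []       _       = false
entryV (b ∷ bs) zero    = b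
entryV (b ∷ bs) (suc r) = entryV bs r

entry : ∀ {hs} → Filling hs → Cell → Bool
entry []       _             = false
entry (v ∷ f)  (zero  , r)   = entryV v r
entry (v ∷ f)  (suc c , r)   = entry f (c , r)

One : ∀ {hs} → Filling hs → Cell → Set
One f x = entry f x ≡ true

onesV : ∀ {h} → Vec Bool h → ℕ
onesV []           = 0
onesV (true  ∷ bs) = suc (onesV bs)
onesV (false ∷ bs) = onesV bs

ones : ∀ {hs} → Filling hs → ℕ
ones []      = 0
ones (v ∷ f) = onesV v + ones f

AtMostOnePerLine : ∀ {hs} → Filling hs → Set
AtMostOnePerLine f =
  (∀ x y → One f x → One f y → col x ≡ col y → x ≡ y) ×
  (∀ x y → One f x → One f y → row x ≡ row y → x ≡ y)

NEstep : Cell → Cell → Set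
NEstep x y = col x < col y × row x < row y

SEstep : Cell → Cell → Set
SEstep x y = col x < col y × row y < row x

IsNEChain : ∀ {hs} → Filling hs → List Cell → Set
IsNEChain f xs = All (One f) xs × Linked NEstep xs

-- smallest rectangle of an SE-chain starting at x and ending at z
-- (z = last cell) lies in the shape
RectIn : Shape → Cell → Cell → Set
RectIn hs x z = ∀ c r → col x ≤ c → c ≤ col z → row z ≤ r → r ≤ row x → (c , r) ∈F hs

lastCell : Cell → List Cell → Cell
lastCell x []       = x
lastCell x (y ∷ ys) = lastCell y ys

RectOK : Shape → List Cell → Set
RectOK hs []       = ⊤
RectOK hs (x ∷ xs) = RectIn hs x (lastCell x xs)

IsSEChain : ∀ {hs} → Filling hs → List Cell → Set
IsSEChain {hs} f xs = All (One f) xs × Linked SEstep xs × RectOK hs xs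

LongestIs : (List Cell → Set) → ℕ → Set
LongestIs C k = (∃ λ xs → C xs × length xs ≡ k) × (∀ xs → C xs → length xs ≤ k)

Counted : (hs : Shape) → ℕ → ℕ → ℕ → Filling hs → Set
Counted hs n s t f =
  ones f ≡ n × AtMostOnePerLine f ×
  LongestIs (IsNEChain f) s × LongestIs (IsSEChain f) t

-- xs is a duplicate-free list of exactly the fillings satisfying P;
-- then N(P) = length xs.
Enumerates : ∀ {hs} → (Filling hs → Set) → List (Filling hs) → Set
Enumerates P xs = Unique xs × (∀ f → (f ∈ xs) ⇔ P f)

{-# OPTIONS --safe #-}

-- The proof is by Fomin's growth diagrams.  Label the edges of the cells of F
-- by Local, starting with unlabelled edges on the left and at the bottom.
-- Reading "just k" as "a box is added in row k", every lattice point of F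
-- carries a partition, and the partitions along the upper right boundary
-- determine the filling, because Local can be inverted cell by cell.  The
-- closed walks in Young's lattice that follow the boundary are exactly the
-- sequences so obtained; transposing all their partitions gives the bijection.
--
-- The partition at the point (c , y) has its first row as long as the longest
-- NE-chain, and its first column as long as the longest SE-chain, among the
-- cells in [0,c) × [0,y).  For the row this is a recursion over the cells.  For
-- the column we follow Viennot: the cells where both outgoing edges carry
-- label k form a filling Level k, Level 0 consists of the ones of the given
-- filling, and passing from Level k to Level (suc k) shortens the longest
-- SE-chain by exactly one.  So it counts the k with Level k nonempty, i.e. the
-- rows of the partition.
module Submission where

open import Defs
open import Data.Bool using (Bool; true; false)
open import Data.Empty using (⊥-elim)
open import Data.List using (List; []; _∷_; _++_; length; map; replicate)
open import Data.List.Membership.Propositional using (_∈_)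
open import Data.List.Properties using (∷-injective; length-++; length-map; map-++)
open import Data.List.Relation.Binary.Pointwise using (Pointwise; []; _∷_; Pointwise-length)
open import Data.List.Relation.Unary.All using (All; []; _∷_; lookup; tabulate)
open import Data.List.Relation.Unary.AllPairs using ([]; _∷_)
open import Data.List.Relation.Unary.Any using (here; there)
open import Data.List.Relation.Unary.Linked using (Linked; []; [-]; _∷_)
open import Data.List.Relation.Unary.Unique.Propositional using (Unique)
import Data.Maybe as Maybe
open import Data.Maybe using (Maybe; just; nothing)
open import Data.Maybe.Properties using (just-injective)
open import Data.Nat
open import Data.Nat.Properties
open import Data.Product using (_×_; _,_; proj₁; proj₂; ∃; ∃₂; swap)
open import Data.Sum using (_⊎_; inj₁; inj₂)
open import Data.Unit using (⊤; tt)
open import Data.Vec using (Vec; []; _∷_)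
open import Function using (_∘_; mk⇔; Equivalence)
open import Relation.Binary.Definitions using (tri<; tri≈; tri>)
open import Relation.Binary.PropositionalEquality
open import Relation.Nullary using (¬_; yes; no; contradiction)

-- Local rules for the edge labels of a cell.

Label : Set
Label = Maybe ℕ

-- Local l b e r t: a cell with entry e whose left, bottom, right and top
-- edges carry the labels l, b, r and t.  The label just k stands for the
-- addition of a box in row k.
data Local : Label → Label → Bool → Label → Label → Set where
  empty  : Local nothing nothing false nothing nothing
  one    : Local nothing nothing true (just 0) (just 0)
  left   : ∀ {k} → Local (just k) nothing false (just k) nothing
  bottom : ∀ {k} → Local nothing (just k) false nothing (just k)
  cross  : ∀ {k l} → k ≢ l → Local (just k) (just l) false (just k) (just l)
  bump   : ∀ {k} → Local (just k) (just k) false (just (suc k)) (just (suc k))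

-- Total, so that every 0-1-matrix gets labels: a one with a labelled incoming edge is treated as a
-- zero, and `Compatible` excludes this case later.
fwd : Label → Label → Bool → Label × Label
fwd nothing  nothing  true  = just 0 , just 0
fwd nothing  nothing  false = nothing , nothing
fwd (just k) nothing  _     = just k , nothing
fwd nothing  (just l) _     = nothing , just l
fwd (just k) (just l) _     with k ≟ l
... | yes _ = just (suc k) , just (suc k)
... | no  _ = just k , just l

fwd-Local : ∀ l b e → (e ≡ true → l ≡ nothing × b ≡ nothing) →
            Local l b e (proj₁ (fwd l b e)) (proj₂ (fwd l b e))
fwd-Local nothing  nothing  true  _ = one
fwd-Local nothing  nothing  false _ = empty
fwd-Local (just k) nothing  false _ = left
fwd-Local nothing  (just l) false _ = bottom
fwd-Local (just k) (just l) false _ with k ≟ l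
... | yes refl = bump
... | no  k≢l  = cross k≢l
fwd-Local (just k) _        true  p with () ← proj₁ (p refl)
fwd-Local nothing  (just l) true  p with () ← proj₂ (p refl)

Local-fwd : ∀ {l b e r t} → Local l b e r t → fwd l b e ≡ (r , t)
Local-fwd empty  = refl
Local-fwd one    = refl
Local-fwd left   = refl
Local-fwd bottom = refl
Local-fwd (cross {k} {l} k≢l) with k ≟ l
... | yes k≡l = contradiction k≡l k≢l
... | no  _   = refl
Local-fwd (bump {k}) with k ≟ k
... | yes _   = refl
... | no  k≢k = contradiction refl k≢k

-- The rule run backwards: two equal labels `just k` come from a one if `k` is 0 and from a bump
-- otherwise; every other pair passes straight through.
Local-total : ∀ r t → ∃ λ l → ∃₂ λ b e → Local l b e r t
Local-total nothing  nothing  = _ , _ , _ , empty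
Local-total (just k) nothing  = _ , _ , _ , left
Local-total nothing  (just l) = _ , _ , _ , bottom
Local-total (just k) (just l) with k ≟ l
Local-total (just k)       (just l)  | no k≢l   = _ , _ , _ , cross k≢l
Local-total (just zero)    (just _)  | yes refl = _ , _ , _ , one
Local-total (just (suc k)) (just _)  | yes refl = _ , _ , _ , bump

Local-injective : ∀ {l b e l′ b′ e′ r t} → Local l b e r t → Local l′ b′ e′ r t →
                  l ≡ l′ × b ≡ b′ × e ≡ e′
Local-injective empty     empty      = refl , refl , refl
Local-injective one       one        = refl , refl , refl
Local-injective one       (cross p)  = contradiction refl p
Local-injective left      left       = refl , refl , refl
Local-injective bottom    bottom     = refl , refl , refl
Local-injective (cross _) (cross _)  = refl , refl , refl
Local-injective (cross p) one        = contradiction refl p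
Local-injective (cross p) bump       = contradiction refl p
Local-injective bump      bump       = refl , refl , refl
Local-injective bump      (cross p)  = contradiction refl p

Local-entry : ∀ {l b e r t} → Local l b e r t → e ≡ true → l ≡ nothing × b ≡ nothing
Local-entry one _ = refl , refl

ind : ℕ → Label → ℕ
ind k nothing  = 0
ind k (just i) with k ≟ i
... | yes _ = 1
... | no  _ = 0

ind-same : ∀ k → ind k (just k) ≡ 1
ind-same k with k ≟ k
... | yes _   = refl
... | no  k≢k = contradiction refl k≢k

ind-positive : ∀ {k l} → 0 < ind k l → l ≡ just k
ind-positive {k} {just i} p with k ≟ i
... | yes refl = refl

-- Bottom then right, or left then top: both ways around a cell add the same boxes, because labels
-- change only where the two incoming edges agree and the two outgoing edges agree.
Local-balance : ∀ {l b e r t} k → Local l b e r t → ind k r + ind k b ≡ ind k l + ind k t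
Local-balance k empty     = refl
Local-balance k one       = +-comm (ind k (just 0)) 0
Local-balance k left      = refl
Local-balance k bottom    = refl
Local-balance k (cross _) = refl
Local-balance k (bump {i}) = +-comm (ind k (just (suc i))) (ind k (just i))

Local-one⁺ : ∀ {l b e r t} → Local l b e r t → e ≡ true → r ≡ just 0 × t ≡ just 0
Local-one⁺ one _ = refl , refl

Local-left : ∀ {l b e r t} → Local l b e r t → r ≡ nothing → l ≡ nothing
Local-left empty  _ = refl
Local-left bottom _ = refl

Local-bottom : ∀ {l b e r t} → Local l b e r t → t ≡ nothing → b ≡ nothing
Local-bottom empty _ = refl
Local-bottom left  _ = refl

Local-one : ∀ {l b e} → Local l b e (just 0) (just 0) → e ≡ true
Local-one one = refl
Local-one (cross p) = contradiction refl p

-- Chains in rectangles.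

-- Chains confined to the rectangle [0,c) × [0,y).
data NE (P : ℕ → ℕ → Set) : ℕ → ℕ → ℕ → Set where
  nil  : ∀ {c y} → NE P c y 0
  snoc : ∀ {c y k} x z → x < c → z < y → P x z → NE P x z k → NE P c y (suc k)

-- Chains confined to [lo,c) × [0,y).
data SE (P : ℕ → ℕ → Set) (c : ℕ) : ℕ → ℕ → ℕ → Set where
  nil  : ∀ {lo y} → SE P c lo y 0
  cons : ∀ {lo y k} x z → lo ≤ x → x < c → z < y → P x z →
         SE P c (suc x) z k → SE P c lo y (suc k)

NE-weaken : ∀ {P c y c′ y′ k} → c ≤ c′ → y ≤ y′ → NE P c y k → NE P c′ y′ k
NE-weaken p q nil                   = nil
NE-weaken p q (snoc x z x<c z<y a n) = snoc x z (<-≤-trans x<c p) (<-≤-trans z<y q) a n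

SE-weaken : ∀ {P c lo y lo′ y′ k} → lo′ ≤ lo → y ≤ y′ → SE P c lo y k → SE P c lo′ y′ k
SE-weaken p q nil = nil
SE-weaken p q (cons x z lo≤x x<c z<y a n) =
  cons x z (≤-trans p lo≤x) x<c (<-≤-trans z<y q) a n

SE-map : ∀ {P Q : ℕ → ℕ → Set} {c lo y k} → (∀ {x z} → P x z → Q x z) → SE P c lo y k → SE Q c lo y k
SE-map f nil = nil
SE-map f (cons x z p q r a n) = cons x z p q r (f a) (SE-map f n)

NE-map : ∀ {P Q : ℕ → ℕ → Set} {c y k} → (∀ {x z} → P x z → Q x z) → NE P c y k → NE Q c y k
NE-map f nil = nil
NE-map f (snoc x z p q a n) = snoc x z p q (f a) (NE-map f n)

-- The edge labels of a filling.

module Diagram (e : ℕ → ℕ → Bool) where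

  -- V c y and H c y label the left and the bottom edge of the cell (c , y).
  V H : ℕ → ℕ → Label
  V zero    y = nothing
  V (suc c) y = proj₁ (fwd (V c y) (H c y) (e c y))
  H c zero    = nothing
  H c (suc y) = proj₂ (fwd (V c y) (H c y) (e c y))

  Compatible : Set
  Compatible = ∀ c y → e c y ≡ true → V c y ≡ nothing × H c y ≡ nothing

  -- After an unlabelled left edge the right edge is labelled only at a one; a label from below
  -- leaves through the top.
  V-nothing : ∀ c y → (∀ x → x < c → e x y ≡ false) → V c y ≡ nothing
  V-nothing zero    y p = refl
  V-nothing (suc c) y p
    rewrite V-nothing c y (λ x x<c → p x (m<n⇒m<1+n x<c)) | p c (n<1+n c) with H c y
  ... | nothing = refl
  ... | just _  = refl

  H-nothing : ∀ c y → (∀ z → z < y → e c z ≡ false) → H c y ≡ nothing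
  H-nothing c zero    p = refl
  H-nothing c (suc y) p
    rewrite H-nothing c y (λ z z<y → p z (m<n⇒m<1+n z<y)) | p y (n<1+n y) with V c y
  ... | nothing = refl
  ... | just _  = refl

  lines⇒compatible : (∀ c c′ y → e c y ≡ true → e c′ y ≡ true → c ≡ c′) →
                     (∀ c y y′ → e c y ≡ true → e c y′ ≡ true → y ≡ y′) → Compatible
  lines⇒compatible rows cols c y p = V-nothing c y left-empty , H-nothing c y below-empty
    where
    left-empty : ∀ x → x < c → e x y ≡ false
    left-empty x x<c with e x y in eq
    ... | false = refl
    ... | true  = contradiction (rows x c y eq p) (<⇒≢ x<c)
    below-empty : ∀ z → z < y → e c z ≡ false
    below-empty z z<y with e c z in eq
    ... | false = refl
    ... | true  = contradiction (cols c z y eq p) (<⇒≢ z<y)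

  compatible⇒local : Compatible →
                     ∀ c y → Local (V c y) (H c y) (e c y) (V (suc c) y) (H c (suc y))
  compatible⇒local compat c y = fwd-Local (V c y) (H c y) (e c y) (compat c y)

-- Shadow lines, chain lengths and row lengths.

module Growth (e : ℕ → ℕ → Bool) (V H : ℕ → ℕ → Label)
  (V-boundary : ∀ y → V 0 y ≡ nothing) (H-boundary : ∀ c → H c 0 ≡ nothing)
  (local : ∀ c y → Local (V c y) (H c y) (e c y) (V (suc c) y) (H c (suc y))) where

  -- No rule takes a labelled left edge to an unlabelled right edge. As a one needs unlabelled
  -- incoming edges, two ones cannot share a row; columns are treated in the same way.
  V-persists : ∀ {c c′ y} → c ≤′ c′ → e c y ≡ true → V (suc c′) y ≢ nothing
  V-persists ≤′-refl p q with () ← trans (sym q) (proj₁ (Local-one⁺ (local _ _) p))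
  V-persists (≤′-step c≤c′) p q = V-persists c≤c′ p (Local-left (local _ _) q)

  H-persists : ∀ {c y y′} → y ≤′ y′ → e c y ≡ true → H c (suc y′) ≢ nothing
  H-persists ≤′-refl p q with () ← trans (sym q) (proj₂ (Local-one⁺ (local _ _) p))
  H-persists (≤′-step y≤y′) p q = H-persists y≤y′ p (Local-bottom (local _ _) q)

  one-incoming : ∀ {c y} → e c y ≡ true → V c y ≡ nothing × H c y ≡ nothing
  one-incoming = Local-entry (local _ _)

  row-distinct : ∀ {c c′ y} → c < c′ → e c y ≡ true → e c′ y ≡ true → c ≡ c′
  row-distinct {c} {suc c′} {y} (s≤s c≤c′) p q =
    contradiction (proj₁ (one-incoming q)) (V-persists (≤⇒≤′ c≤c′) p)

  column-distinct : ∀ {c y y′} → y < y′ → e c y ≡ true → e c y′ ≡ true → y ≡ y′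
  column-distinct {c} {y} {suc y′} (s≤s y≤y′) p q =
    contradiction (proj₂ (one-incoming q)) (H-persists (≤⇒≤′ y≤y′) p)

  unique-rows : ∀ c c′ y → e c y ≡ true → e c′ y ≡ true → c ≡ c′
  unique-rows c c′ y p q with <-cmp c c′
  ... | tri< c<c′ _ _ = row-distinct c<c′ p q
  ... | tri≈ _ c≡c′ _ = c≡c′
  ... | tri> _ _ c′<c = sym (row-distinct c′<c q p)

  unique-columns : ∀ c y y′ → e c y ≡ true → e c y′ ≡ true → y ≡ y′
  unique-columns c y y′ p q with <-cmp y y′
  ... | tri< y<y′ _ _ = column-distinct y<y′ p q
  ... | tri≈ _ y≡y′ _ = y≡y′
  ... | tri> _ _ y′<y = sym (column-distinct y′<y q p)

  -- The edges labelled k form Viennot's shadow lines, with lower left corners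
  -- at the cells of Level k and upper right corners at those of Level (suc k).
  Level : ℕ → ℕ → ℕ → Set
  Level k c y = V (suc c) y ≡ just k × H c (suc y) ≡ just k

  Level-0⇒one : ∀ {c y} → Level 0 c y → e c y ≡ true
  Level-0⇒one {c} {y} (p , q) = Local-one (subst₂ (Local _ _ _) p q (local c y))

  one⇒Level-0 : ∀ {c y} → e c y ≡ true → Level 0 c y
  one⇒Level-0 = Local-one⁺ (local _ _)

  bumped : ∀ {k c y} → V c y ≡ just k → H c y ≡ just k → Level (suc k) c y
  bumped {k} {c} {y} p q with V c y | H c y | e c y | V (suc c) y | H c (suc y) | local c y
  bumped refl refl | _ | _ | _ | _ | _ | bump    = refl , refl
  bumped refl refl | _ | _ | _ | _ | _ | cross p = contradiction refl p

  unbumped : ∀ {k c y} → Level (suc k) c y → V c y ≡ just k × H c y ≡ just k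
  unbumped {k} {c} {y} (p , q) with V c y | H c y | e c y | V (suc c) y | H c (suc y) | local c y
  unbumped (refl , refl) | _ | _ | _ | _ | _ | bump    = refl , refl
  unbumped (refl , refl) | _ | _ | _ | _ | _ | cross p = contradiction refl p

  incoming∉Level : ∀ {k c y} → V c y ≡ just k → ¬ Level k c y
  incoming∉Level {k} {c} {y} p (q , r) with V c y | H c y | e c y | V (suc c) y | H c (suc y) | local c y
  incoming∉Level refl (refl , refl) | _ | _ | _ | _ | _ | cross p = p refl

  V-next : ∀ {k c y} → V c y ≡ just k → V (suc c) y ≡ just k ⊎ Level (suc k) c y
  V-next {k} {c} {y} p with V c y | H c y | e c y | V (suc c) y | H c (suc y) | local c y
  V-next refl | _ | _ | _ | _ | _ | left    = inj₁ refl
  V-next refl | _ | _ | _ | _ | _ | cross _ = inj₁ refl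
  V-next refl | _ | _ | _ | _ | _ | bump    = inj₂ (refl , refl)

  H-next : ∀ {k c y} → H c y ≡ just k → H c (suc y) ≡ just k ⊎ Level (suc k) c y
  H-next {k} {c} {y} p with V c y | H c y | e c y | V (suc c) y | H c (suc y) | local c y
  H-next refl | _ | _ | _ | _ | _ | bottom  = inj₁ refl
  H-next refl | _ | _ | _ | _ | _ | cross _ = inj₁ refl
  H-next refl | _ | _ | _ | _ | _ | bump    = inj₂ (refl , refl)

  V-prev : ∀ {k c y} → V (suc c) y ≡ just k → V c y ≡ just k ⊎ Level k c y
  V-prev {k} {c} {y} p with V c y | H c y | e c y | V (suc c) y | H c (suc y) | local c y
  V-prev refl | _ | _ | _ | _ | _ | one     = inj₂ (refl , refl)
  V-prev refl | _ | _ | _ | _ | _ | left    = inj₁ refl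
  V-prev refl | _ | _ | _ | _ | _ | cross _ = inj₁ refl
  V-prev refl | _ | _ | _ | _ | _ | bump    = inj₂ (refl , refl)

  H-prev : ∀ {k c y} → H c (suc y) ≡ just k → H c y ≡ just k ⊎ Level k c y
  H-prev {k} {c} {y} p with V c y | H c y | e c y | V (suc c) y | H c (suc y) | local c y
  H-prev refl | _ | _ | _ | _ | _ | one     = inj₂ (refl , refl)
  H-prev refl | _ | _ | _ | _ | _ | bottom  = inj₁ refl
  H-prev refl | _ | _ | _ | _ | _ | cross _ = inj₁ refl
  H-prev refl | _ | _ | _ | _ | _ | bump    = inj₂ (refl , refl)

  -- The line is followed back to the corner where it starts, which exists because the boundary is
  -- unlabelled. The labels on the way are kept for the crossing argument in `lower`.
  trace-left : ∀ {k} c y → V c y ≡ just k →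
               ∃ λ u → u < c × Level k u y × (∀ x → u < x → x ≤ c → V x y ≡ just k)
  trace-left zero    y p with () ← trans (sym (V-boundary y)) p
  trace-left (suc c) y p with V-prev {c = c} p
  ... | inj₂ l = c , n<1+n c , l , λ x c<x x≤1+c → trans (cong (λ x → V x y) (≤-antisym x≤1+c c<x)) p
  ... | inj₁ q with trace-left c y q
  ... | u , u<c , l , f = u , m<n⇒m<1+n u<c , l , g
    where
    g : ∀ x → u < x → x ≤ suc c → V x y ≡ just _
    g x u<x x≤1+c with m≤n⇒m<n∨m≡n x≤1+c
    ... | inj₁ (s≤s x≤c) = f x u<x x≤c
    ... | inj₂ refl      = p

  trace-down : ∀ {k} c y → H c y ≡ just k →
               ∃ λ v → v < y × Level k c v × (∀ z → v < z → z ≤ y → H c z ≡ just k)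
  trace-down c zero    p with () ← trans (sym (H-boundary c)) p
  trace-down c (suc y) p with H-prev {y = y} p
  ... | inj₂ l = y , n<1+n y , l , λ z y<z z≤1+y → trans (cong (H c) (≤-antisym z≤1+y y<z)) p
  ... | inj₁ q with trace-down c y q
  ... | v , v<y , l , f = v , m<n⇒m<1+n v<y , l , g
    where
    g : ∀ z → v < z → z ≤ suc y → H c z ≡ just _
    g z v<z z≤1+y with m≤n⇒m<n∨m≡n z≤1+y
    ... | inj₁ (s≤s z≤y) = f z v<z z≤y
    ... | inj₂ refl      = p

  scan-right : ∀ {k c c′ y} → c ≤′ c′ → V c y ≡ just k →
               (∃ λ x → c ≤ x × x < c′ × Level (suc k) x y) ⊎ V c′ y ≡ just k
  scan-right ≤′-refl p = inj₂ p
  scan-right (≤′-step c≤c′) p with scan-right c≤c′ p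
  ... | inj₁ (x , c≤x , x<c′ , l) = inj₁ (x , c≤x , m<n⇒m<1+n x<c′ , l)
  ... | inj₂ q with V-next q
  ... | inj₁ r = inj₂ r
  ... | inj₂ l = inj₁ (_ , ≤′⇒≤ c≤c′ , n<1+n _ , l)

  scan-up : ∀ {k c y y′} → y ≤′ y′ → H c y ≡ just k →
            (∃ λ z → y ≤ z × z < y′ × Level (suc k) c z) ⊎ H c y′ ≡ just k
  scan-up ≤′-refl p = inj₂ p
  scan-up (≤′-step y≤y′) p with scan-up y≤y′ p
  ... | inj₁ (z , y≤z , z<y′ , l) = inj₁ (z , y≤z , m<n⇒m<1+n z<y′ , l)
  ... | inj₂ q with H-next q
  ... | inj₁ r = inj₂ r
  ... | inj₂ l = inj₁ (_ , ≤′⇒≤ y≤y′ , n<1+n _ , l)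

  -- Follow the line from the upper left cell to the right and the line from the lower right cell
  -- upwards. Either one of them ends early, at a cell of `Level (suc k)`, or they meet at
  -- `(c′ , y)` and bump there.
  between : ∀ {k c c′ y y′} → Level k c y → Level k c′ y′ → c < c′ → y′ < y →
            (∃ λ x → c < x × x ≤ c′ × Level (suc k) x y) ⊎
            (∃ λ z → y′ < z × z ≤ y × Level (suc k) c′ z)
  between {y = y} (p , _) (_ , q) c<c′ y′<y with scan-right (≤⇒≤′ c<c′) p
  ... | inj₁ (x , c<x , x<c′ , l) = inj₁ (x , c<x , <⇒≤ x<c′ , l)
  ... | inj₂ v with scan-up (≤⇒≤′ y′<y) q
  ... | inj₁ (z , y′<z , z<y , l) = inj₂ (z , y′<z , <⇒≤ z<y , l)
  ... | inj₂ h = inj₂ (y , y′<y , ≤-refl , bumped v h)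

  -- Each pair of consecutive cells yields a cell by `between`, right of the first, above the
  -- second, and within the rectangle they span. Such regions for successive pairs lie strictly
  -- south-east of each other, so the new cells form a chain.
  raise : ∀ {k c x z m} → Level k x z → SE (Level k) c (suc x) z m →
          SE (Level (suc k)) c (suc x) (suc z) m
  raise a nil = nil
  raise a (cons x₁ z₁ x<x₁ x₁<c z₁<z a₁ n) with between a a₁ x<x₁ z₁<z
  ... | inj₁ (x , x₀<x , x≤x₁ , l) =
    cons x _ x₀<x (≤-<-trans x≤x₁ x₁<c) (n<1+n _) l (SE-weaken (s≤s x≤x₁) z₁<z (raise a₁ n))
  ... | inj₂ (z , z₁<z , z≤z₀ , l) =
    cons x₁ z x<x₁ x₁<c (s≤s z≤z₀) l (SE-weaken ≤-refl z₁<z (raise a₁ n))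

  -- The chain in Level k starts in the row z of the given cell of
  -- Level (suc k), at the left end u of the line through that cell; its
  -- remaining cells lie in columns ≥ x.
  lower : ∀ {k c x z m} → Level (suc k) x z → x < c → SE (Level (suc k)) c (suc x) z m →
          ∃ λ u → u < x × Level k u z × (∀ w → u < w → w ≤ x → V w z ≡ just k) ×
                  SE (Level k) c x z (suc m)
  lower {k} {c} {x} {z} a x<c n with unbumped a
  -- Both lines that bump at `(x , z)` are followed back, to `u` in its row and to `y` in its
  -- column.
  ... | v , h with trace-left x z v | trace-down x z h
  lower {x = x} a x<c nil | v , h | u , u<x , lu , f | y , y<z , ly , g =
    u , u<x , lu , f , cons x y ≤-refl x<c y<z ly nil
  lower {k} {c} {x} {z} a x<c (cons x₁ z₁ x<x₁ x₁<c z₁<z a₁ n)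
    | v , h | u , u<x , lu , f | y , y<z , ly , g
    with lower a₁ x₁<c n
  ... | u₁ , u₁<x₁ , lu₁ , f₁ , n₁ with x ≤? u₁
  ... | yes x≤u₁ =
    u , u<x , lu , f , cons u₁ z₁ x≤u₁ (<-trans u₁<x₁ x₁<c) z₁<z lu₁ (SE-weaken u₁<x₁ ≤-refl n₁)
  -- The line in row `z₁` now passes through column `x`, so the corner `(x , y)` of the vertical
  -- line takes the place of `(u₁ , z₁)`.
  ... | no  x≰u₁ =
    u , u<x , lu , f , cons x y ≤-refl x<c y<z ly (SE-weaken x<x₁ (<⇒≤ z₁<y) n₁)
    where
    vx : V x z₁ ≡ just k
    vx = f₁ x (≰⇒> x≰u₁) (<⇒≤ x<x₁)
    -- The row line enters `(x , z₁)` with label `k`, so this cell is not in `Level k` and differs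
    -- from `(x , y)`. If `y < z₁`, the vertical line would enter it from below and both would bump,
    -- but the row line continues towards `x₁` with label `k`.
    z₁<y : z₁ < y
    z₁<y with <-cmp y z₁
    ... | tri> _ _ z₁<y = z₁<y
    ... | tri≈ _ refl _ = contradiction ly (incoming∉Level vx)
    ... | tri< y<z₁ _ _ = contradiction
      (just-injective (trans (sym (proj₁ (bumped vx (g z₁ y<z₁ (<⇒≤ z₁<z)))))
                             (f₁ (suc x) (m<n⇒m<1+n (≰⇒> x≰u₁)) x<x₁)))
      1+n≢n

  raise-all : ∀ {k c y} m → SE (Level k) c 0 y (suc m) → SE (Level (m + k)) c 0 y 1
  raise-all zero    n = n
  raise-all {k} {c} {y} (suc m) (cons x z _ x<c z<y a n) =
    subst (λ j → SE (Level j) c 0 y 1) (+-suc m k)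
      (raise-all m (SE-weaken z≤n z<y (raise a n)))

  lower-all : ∀ {k c y} m → SE (Level (m + k)) c 0 y 1 → SE (Level k) c 0 y (suc m)
  lower-all zero n = n
  lower-all {k} {c} {y} (suc m) n
    with lower-all m (subst (λ j → SE (Level j) c 0 y 1) (sym (+-suc m k)) n)
  ... | cons x z _ x<c z<y a n′ with lower a x<c n′
  ... | u , u<x , lu , _ , n″ =
    cons u z z≤n (<-trans u<x x<c) z<y lu (SE-weaken u<x ≤-refl n″)

  -- The length of row `k` of the partition at the point `(c , y)`, read off along the vertical line
  -- from the empty partition at `(c , 0)`.
  count : ℕ → ℕ → ℕ → ℕ
  count k c zero    = 0
  count k c (suc y) = ind k (V c y) + count k c y

  -- Path independence: crossing a horizontal edge adds the box that its label names. The induction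
  -- adds one cell at a time by `Local-balance`.
  count-column : ∀ k c y → count k (suc c) y ≡ count k c y + ind k (H c y)
  count-column k c zero    = sym (cong (ind k) (H-boundary c))
  count-column k c (suc y) = begin
    ind k (V (suc c) y) + count k (suc c) y          ≡⟨ cong (ind k (V (suc c) y) +_) (count-column k c y) ⟩
    ind k (V (suc c) y) + (count k c y + ind k (H c y)) ≡⟨ exchange (ind k (V (suc c) y)) _ _ ⟩
    (ind k (V (suc c) y) + ind k (H c y)) + count k c y
      ≡⟨ cong (_+ count k c y) (Local-balance k (local c y)) ⟩
    (ind k (V c y) + ind k (H c (suc y))) + count k c y ≡⟨ exchange (ind k (V c y)) _ _ ⟨
    ind k (V c y) + (count k c y + ind k (H c (suc y))) ≡⟨ +-assoc (ind k (V c y)) _ _ ⟨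
    ind k (V c y) + count k c y + ind k (H c (suc y))   ∎
    where
    open ≡-Reasoning
    exchange : ∀ a b d → a + (b + d) ≡ (a + d) + b
    exchange a b d = trans (cong (a +_) (+-comm b d)) (sym (+-assoc a d b))

  count-mono-column : ∀ k {c c′} y → c ≤′ c′ → count k c y ≤ count k c′ y
  count-mono-column k y ≤′-refl = ≤-refl
  count-mono-column k {c} {suc c′} y (≤′-step p) = ≤-trans (count-mono-column k y p)
    (≤-trans (m≤m+n _ _) (≤-reflexive (sym (count-column k c′ y))))

  count-mono-row : ∀ k c {y y′} → y ≤′ y′ → count k c y ≤ count k c y′
  count-mono-row k c ≤′-refl     = ≤-refl
  count-mono-row k c (≤′-step p) = ≤-trans (count-mono-row k c p) (m≤n+m _ _)

  count-mono : ∀ k {c c′ y y′} → c ≤ c′ → y ≤ y′ → count k c y ≤ count k c′ y′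
  count-mono k {c′ = c′} {y} p q =
    ≤-trans (count-mono-column k y (≤⇒≤′ p)) (count-mono-row k c′ (≤⇒≤′ q))

  Level-count : ∀ {k c y} → Level k c y → suc (count k c y) ≤ count k (suc c) (suc y)
  Level-count {k} {c} {y} (p , _) rewrite p | ind-same k =
    s≤s (count-mono k (n≤1+n c) (≤-refl {y}))

  count-positive : ∀ {k c} y → 0 < count k c y → ∃ λ z → z < y × V c z ≡ just k
  count-positive {k} {c} (suc y) p with ind k (V c y) in eq
  ... | suc _ = y , n<1+n y , ind-positive (subst (0 <_) (sym eq) (s≤s z≤n))
  ... | zero  with count-positive y p
  ... | z , z<y , q = z , m<n⇒m<1+n z<y , q

  -- Raising `m` times leaves a cell of `Level m`, whose right edge puts a box into row `m`.
  -- Conversely, `count⇒SE` traces an edge labelled `m` back to a cell of `Level m` and lowers it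
  -- `m` times.
  SE⇒count : ∀ {c y} m → SE (Level 0) c 0 y (suc m) → 0 < count m c y
  SE⇒count {c} {y} m n with subst (λ k → SE (Level k) c 0 y 1) (+-identityʳ m) (raise-all m n)
  ... | cons x z _ x<c z<y a nil =
    <-≤-trans (≤-<-trans z≤n (Level-count a)) (count-mono m x<c z<y)

  count⇒SE : ∀ {c y} m → 0 < count m c y → SE (Level 0) c 0 y (suc m)
  count⇒SE {c} {y} m p with count-positive y p
  ... | z , z<y , v with trace-left c z v
  ... | u , u<c , l , _ = lower-all m (subst (λ k → SE (Level k) c 0 y 1) (sym (+-identityʳ m))
                                         (cons u z z≤n u<c z<y l nil))

  NE≤count : ∀ {c y k} → NE (Level 0) c y k → k ≤ count 0 c y
  NE≤count nil = z≤n
  NE≤count (snoc x z x<c z<y a n) =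
    ≤-trans (s≤s (NE≤count n)) (≤-trans (Level-count a) (count-mono 0 x<c z<y))

  count-zero : ∀ k y → count k 0 y ≡ 0
  count-zero k zero    = refl
  count-zero k (suc y) = cong₂ _+_ (cong (ind k) (V-boundary y)) (count-zero k y)

  -- If the cell holds no one, its right or its top edge does not carry label 0, so the first row
  -- does not grow along that edge and the chain below or beside the cell serves. A one has
  -- unlabelled incoming edges and prolongs the chain of the lower left corner.
  NE-extend : ∀ c y → NE (Level 0) c y (count 0 c y) → NE (Level 0) (suc c) y (count 0 (suc c) y) →
              NE (Level 0) c (suc y) (count 0 c (suc y)) →
              NE (Level 0) (suc c) (suc y) (count 0 (suc c) (suc y))
  NE-extend c y corner below beside =
    cell (V c y) (H c y) (e c y) (V (suc c) y) (H c (suc y)) refl refl refl (local c y)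
    where
    n = count 0 (suc c) (suc y)
    from-below : ind 0 (V (suc c) y) ≡ 0 → NE (Level 0) (suc c) (suc y) n
    from-below p = subst (NE _ _ _) (cong (_+ count 0 (suc c) y) (sym p))
      (NE-weaken ≤-refl (n≤1+n y) below)
    from-left : ind 0 (H c (suc y)) ≡ 0 → NE (Level 0) (suc c) (suc y) n
    from-left p = subst (NE _ _ _)
      (sym (trans (count-column 0 c (suc y)) (trans (cong (count 0 c (suc y) +_) p) (+-identityʳ _))))
      (NE-weaken (n≤1+n c) ≤-refl beside)
    cell : ∀ l b d r t → H c y ≡ b → V (suc c) y ≡ r → H c (suc y) ≡ t → Local l b d r t →
           NE (Level 0) (suc c) (suc y) n
    cell _ _ _ _ _ b r t one = subst (NE _ _ _) eq
      (snoc c y (n<1+n c) (n<1+n y) (r , t) corner)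
      where
      eq : suc (count 0 c y) ≡ n
      eq = sym (cong₂ _+_ (cong (ind 0) r) (trans (count-column 0 c y)
             (trans (cong (count 0 c y +_) (cong (ind 0) b)) (+-identityʳ _))))
    cell _ _ _ _ _ b r t empty  = from-below (cong (ind 0) r)
    cell _ _ _ _ _ b r t left   = from-left (cong (ind 0) t)
    cell _ _ _ _ _ b r t bottom = from-below (cong (ind 0) r)
    cell _ _ _ _ _ b r t bump   = from-below (cong (ind 0) r)
    cell _ _ _ _ _ b r t (cross {zero} {zero} p)    = contradiction refl p
    cell _ _ _ _ _ b r t (cross {zero} {suc l} p)   = from-left (cong (ind 0) t)
    cell _ _ _ _ _ b r t (cross {suc k} p)          = from-below (cong (ind 0) r)

  count⇒NE : ∀ c y → NE (Level 0) c y (count 0 c y)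
  count⇒NE zero    y       = subst (NE _ _ _) (sym (count-zero 0 y)) nil
  count⇒NE (suc c) zero    = nil
  count⇒NE (suc c) (suc y) =
    NE-extend c y (count⇒NE c y) (count⇒NE (suc c) y) (count⇒NE c (suc y))

-- Partitions and the addition of a box.

Box : Set
Box = ℕ × ℕ

-- Required in both directions, this says that the two functions describe the same set of boxes,
-- which forces both to be weakly decreasing and eventually zero.
Galois : (ℕ → ℕ) → (ℕ → ℕ) → Set
Galois f g = ∀ {i j} → j < f i → i < g j

-- A partition together with its conjugate.
record State : Set where
  field
    rowLen colLen : ℕ → ℕ
    row⇒col : Galois rowLen colLen
    col⇒row : Galois colLen rowLen
open State

∅ : State
∅ = record { rowLen = λ _ → 0 ; colLen = λ _ → 0
           ; row⇒col = λ p → ⊥-elim (n≮0 p) ; col⇒row = λ p → ⊥-elim (n≮0 p) }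

transpose : State → State
transpose S = record { rowLen = colLen S ; colLen = rowLen S
                     ; row⇒col = col⇒row S ; col⇒row = row⇒col S }

infix 4 _≈_
record _≈_ (S T : State) : Set where
  constructor _,_
  field
    rows≡ : ∀ k → rowLen S k ≡ rowLen T k
    columns≡ : ∀ k → colLen S k ≡ colLen T k
open _≈_

≈-refl : ∀ {S} → S ≈ S
≈-refl = (λ _ → refl) , (λ _ → refl)

≈-sym : ∀ {S T} → S ≈ T → T ≈ S
≈-sym (p , q) = (λ k → sym (p k)) , (λ k → sym (q k))

≈-trans : ∀ {S T U} → S ≈ T → T ≈ U → S ≈ U
≈-trans (p , q) (p′ , q′) = (λ k → trans (p k) (p′ k)) , (λ k → trans (q k) (q′ k))

-- `row-old` and `col-old` make `b` an addable corner of `S`: the first free place both in its row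
-- and in its column.
record Add (S : State) (b : Box) (T : State) : Set where
  field
    row-old  : rowLen S (proj₁ b) ≡ proj₂ b
    col-old  : colLen S (proj₂ b) ≡ proj₁ b
    row-new  : rowLen T (proj₁ b) ≡ suc (proj₂ b)
    col-new  : colLen T (proj₂ b) ≡ suc (proj₁ b)
    row-rest : ∀ k → k ≢ proj₁ b → rowLen T k ≡ rowLen S k
    col-rest : ∀ k → k ≢ proj₂ b → colLen T k ≡ colLen S k
open Add

update : (ℕ → ℕ) → ℕ → ℕ → ℕ → ℕ
update f i v k with k ≟ i
... | yes _ = v
... | no  _ = f k

update-same : ∀ f i v → update f i v i ≡ v
update-same f i v with i ≟ i
... | yes _   = refl
... | no  i≢i = contradiction refl i≢i

update-other : ∀ f i v k → k ≢ i → update f i v k ≡ f k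
update-other f i v k k≢i with k ≟ i
... | yes k≡i = contradiction k≡i k≢i
... | no  _   = refl

Galois-add : ∀ {f g i j} → Galois f g → f i ≡ j → g j ≡ i →
             Galois (update f i (suc j)) (update g j (suc i))
Galois-add {i = i} {j} G fi gj {i′} {j′} p with i′ ≟ i | j′ ≟ j
... | yes refl | yes refl = n<1+n i
... | yes refl | no  j′≢j = G (subst (j′ <_) (sym fi) (≤∧≢⇒< (s≤s⁻¹ p) j′≢j))
... | no  _    | yes refl = m<n⇒m<1+n (subst (i′ <_) gj (G p))
... | no  _    | no  _    = G p

Galois-remove : ∀ {f g i j} → Galois f g → f i ≡ suc j → g j ≡ suc i →
                Galois (update f i j) (update g j i)
Galois-remove {i = i} {j} G fi gj {i′} {j′} p with i′ ≟ i | j′ ≟ j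
... | yes refl | yes refl = contradiction p (<-irrefl refl)
... | yes refl | no  _    = G (subst (j′ <_) (sym fi) (m<n⇒m<1+n p))
... | no  i′≢i | yes refl = ≤∧≢⇒< (s≤s⁻¹ (subst (i′ <_) gj (G p))) i′≢i
... | no  _    | no  _    = G p

insert : ∀ S i j → rowLen S i ≡ j → colLen S j ≡ i → ∃ λ T → Add S (i , j) T
insert S i j p q =
  record { rowLen = update (rowLen S) i (suc j) ; colLen = update (colLen S) j (suc i)
         ; row⇒col = Galois-add (row⇒col S) p q ; col⇒row = Galois-add (col⇒row S) q p } ,
  record { row-old = p ; col-old = q
         ; row-new = update-same (rowLen S) i (suc j) ; col-new = update-same (colLen S) j (suc i)
         ; row-rest = update-other (rowLen S) i (suc j) ; col-rest = update-other (colLen S) j (suc i) }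

delete : ∀ T i j → rowLen T i ≡ suc j → colLen T j ≡ suc i → ∃ λ S → Add S (i , j) T
delete T i j p q =
  record { rowLen = update (rowLen T) i j ; colLen = update (colLen T) j i
         ; row⇒col = Galois-remove (row⇒col T) p q ; col⇒row = Galois-remove (col⇒row T) q p } ,
  record { row-old = update-same (rowLen T) i j ; col-old = update-same (colLen T) j i
         ; row-new = p ; col-new = q
         ; row-rest = λ k k≢i → sym (update-other (rowLen T) i j k k≢i)
         ; col-rest = λ k k≢j → sym (update-other (colLen T) j i k k≢j) }

Add-resp : ∀ {S S′ b T T′} → S ≈ S′ → T ≈ T′ → Add S b T → Add S′ b T′
Add-resp (p , q) (p′ , q′) a = record
  { row-old = trans (sym (p _)) (row-old a) ; col-old = trans (sym (q _)) (col-old a)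
  ; row-new = trans (sym (p′ _)) (row-new a) ; col-new = trans (sym (q′ _)) (col-new a)
  ; row-rest = λ k n → trans (sym (p′ k)) (trans (row-rest a k n) (p k))
  ; col-rest = λ k n → trans (sym (q′ k)) (trans (col-rest a k n) (q k)) }

Add-transpose : ∀ {S b T} → Add S b T → Add (transpose S) (swap b) (transpose T)
Add-transpose a = record
  { row-old = col-old a ; col-old = row-old a ; row-new = col-new a ; col-new = row-new a
  ; row-rest = col-rest a ; col-rest = row-rest a }

Add-functional : ∀ {S S′ b T T′} → S ≈ S′ → Add S b T → Add S′ b T′ → T ≈ T′
Add-functional {b = i , j} (p , q) a a′ = rows , columns
  where
  rows : ∀ k → _
  rows k with k ≟ i
  ... | yes refl = trans (row-new a) (sym (row-new a′))
  ... | no  k≢i  = trans (row-rest a k k≢i) (trans (p k) (sym (row-rest a′ k k≢i)))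
  columns : ∀ k → _
  columns k with k ≟ j
  ... | yes refl = trans (col-new a) (sym (col-new a′))
  ... | no  k≢j  = trans (col-rest a k k≢j) (trans (q k) (sym (col-rest a′ k k≢j)))

Add-injective : ∀ {S S′ b T T′} → T ≈ T′ → Add S b T → Add S′ b T′ → S ≈ S′
Add-injective {b = i , j} (p , q) a a′ = rows , columns
  where
  rows : ∀ k → _
  rows k with k ≟ i
  ... | yes refl = trans (row-old a) (sym (row-old a′))
  ... | no  k≢i  = trans (sym (row-rest a k k≢i)) (trans (p k) (row-rest a′ k k≢i))
  columns : ∀ k → _
  columns k with k ≟ j
  ... | yes refl = trans (col-old a) (sym (col-old a′))
  ... | no  k≢j  = trans (sym (col-rest a k k≢j)) (trans (q k) (col-rest a′ k k≢j))

-- Two boxes added to the same partition in different rows also lie in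
-- different columns, so the two additions commute.
Add-columns : ∀ {S i j i′ j′ T T′} → Add S (i , j) T → Add S (i′ , j′) T′ → i ≢ i′ → j ≢ j′
Add-columns a a′ i≢i′ refl = i≢i′ (trans (sym (col-old a)) (col-old a′))

Remove-columns : ∀ {S i j i′ j′ T T′} → Add T (i , j) S → Add T′ (i′ , j′) S → i ≢ i′ → j ≢ j′
Remove-columns a a′ i≢i′ refl = i≢i′ (suc-injective (trans (sym (col-new a)) (col-new a′)))

-- Labelled steps and the local rules on partitions.

data Step (S : State) : Maybe Box → State → Set where
  stay : ∀ {T} → S ≈ T → Step S nothing T
  add  : ∀ {b T} → Add S b T → Step S (just b) T

rowOf : Maybe Box → Label
rowOf = Maybe.map proj₁

transposeBox : Maybe Box → Maybe Box
transposeBox = Maybe.map swap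

Step-resp : ∀ {S S′ b T T′} → S ≈ S′ → T ≈ T′ → Step S b T → Step S′ b T′
Step-resp p q (stay s) = stay (≈-trans (≈-sym p) (≈-trans s q))
Step-resp p q (add a)  = add (Add-resp p q a)

Step-transpose : ∀ {S b T} → Step S b T → Step (transpose S) (transposeBox b) (transpose T)
Step-transpose (stay (p , q)) = stay (q , p)
Step-transpose (add a)        = add (Add-transpose a)

-- The label names only the row; the column is the length of that row in `S`. In `Step-injective`
-- the length in `T` plays the same part.
Step-functional : ∀ {S S′ b b′ T T′} → S ≈ S′ → Step S b T → Step S′ b′ T′ → rowOf b ≡ rowOf b′ →
                  b ≡ b′ × T ≈ T′
Step-functional p (stay s) (stay s′) _ = refl , ≈-trans (≈-sym s) (≈-trans p s′)
Step-functional p (add {i , j} a) (add {.i , j′} a′) refl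
  with refl ← trans (sym (row-old a)) (trans (rows≡ p i) (row-old a′)) =
  refl , Add-functional p a a′

Step-injective : ∀ {S S′ b b′ T T′} → T ≈ T′ → Step S b T → Step S′ b′ T′ → rowOf b ≡ rowOf b′ →
                 b ≡ b′ × S ≈ S′
Step-injective p (stay s) (stay s′) _ = refl , ≈-trans s (≈-trans p (≈-sym s′))
Step-injective p (add {i , j} a) (add {.i , j′} a′) refl
  with refl ← suc-injective (trans (sym (row-new a)) (trans (rows≡ p i) (row-new a′))) =
  refl , Add-injective p a a′

Step-count : ∀ {S b T} k → Step S b T → rowLen T k ≡ ind k (rowOf b) + rowLen S k
Step-count k (stay (p , _)) = sym (p k)
Step-count k (add {i , j} a) with k ≟ i
... | yes refl = trans (row-new a) (cong suc (sym (row-old a)))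
... | no  k≢i  = row-rest a k k≢i

insert-row-0 : ∀ S → ∃₂ λ j T → Add S (0 , j) T
insert-row-0 S with colLen S (rowLen S 0) in eq
... | zero  = rowLen S 0 , insert S 0 _ refl eq
... | suc _ = contradiction (col⇒row S (subst (0 <_) (sym eq) (s≤s z≤n))) (<-irrefl refl)

-- In `R` row `suc i` is at most as long as row `i`, and row `i` has just grown; it is now strictly
-- longer, so the row after it has room. This makes `bump` possible.
insert-next-row : ∀ {R i j S} → Add R (i , j) S → ∃₂ λ j′ T → Add S (suc i , j′) T
insert-next-row {R} {i} {j} {S} a = rowLen S (suc i) , insert S (suc i) _ refl (≤-antisym upper lower)
  where
  j′ = rowLen S (suc i)
  upper : colLen S j′ ≤ suc i
  upper = ≮⇒≥ λ p → <-irrefl refl (col⇒row S p)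
  j′≤j : j′ ≤ j
  j′≤j = ≮⇒≥ λ p → <⇒≱ (row⇒col R (subst (j <_) (row-rest a (suc i) 1+n≢n) p))
                        (≤-trans (≤-reflexive (col-old a)) (n≤1+n i))
  lower : suc i ≤ colLen S j′
  lower = row⇒col S (subst (j′ <_) (sym (row-new a)) (s≤s j′≤j))

-- Row `suc i` of `S` can take a box, so row `i` is strictly longer and its last box has nothing
-- beyond it in its column. This undoes `bump`.
delete-previous-row : ∀ {S i j T} → Add S (suc i , j) T → ∃₂ λ j′ R → Add R (i , j′) S
delete-previous-row {S} {i} {j} a
  with rowLen S i in eq | col⇒row S {j} {i} (subst (i <_) (sym (col-old a)) (n<1+n i))
... | zero   | p = contradiction p λ ()
... | suc j′ | p = j′ , delete S i j′ eq (≤-antisym upper lower)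
  where
  upper : colLen S j′ ≤ suc i
  upper = ≮⇒≥ λ q → <⇒≱ (subst (j′ <_) (row-old a) (col⇒row S q)) (s≤s⁻¹ p)
  lower : suc i ≤ colLen S j′
  lower = row⇒col S (subst (j′ <_) (sym eq) (n<1+n j′))

Add-commute : ∀ {R b b′ S T} → Add R b S → Add R b′ T → proj₁ b ≢ proj₁ b′ →
              ∃ λ U → Add T b U × Add S b′ U
Add-commute {b = i , j} {i′ , j′} {S} {T} a a′ i≢i′
  with insert T i j (trans (row-rest a′ i i≢i′) (row-old a))
                    (trans (col-rest a′ j (Add-columns a a′ i≢i′)) (col-old a))
... | U , u = U , u , record
  { row-old = trans (row-rest a i′ i′≢i) (row-old a′)
  ; col-old = trans (col-rest a j′ j′≢j) (col-old a′)
  ; row-new = trans (row-rest u i′ i′≢i) (row-new a′)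
  ; col-new = trans (col-rest u j′ j′≢j) (col-new a′)
  ; row-rest = rows ; col-rest = columns }
  where
  i′≢i = ≢-sym i≢i′
  j′≢j = ≢-sym (Add-columns a a′ i≢i′)
  rows : ∀ k → k ≢ i′ → rowLen U k ≡ rowLen S k
  rows k k≢i′ with k ≟ i
  ... | yes refl = trans (row-new u) (sym (row-new a))
  ... | no  k≢i  = trans (row-rest u k k≢i) (trans (row-rest a′ k k≢i′) (sym (row-rest a k k≢i)))
  columns : ∀ k → k ≢ j′ → colLen U k ≡ colLen S k
  columns k k≢j′ with k ≟ j
  ... | yes refl = trans (col-new u) (sym (col-new a))
  ... | no  k≢j  = trans (col-rest u k k≢j) (trans (col-rest a′ k k≢j′) (sym (col-rest a k k≢j)))

Remove-commute : ∀ {U b b′ S T} → Add T b U → Add S b′ U → proj₁ b ≢ proj₁ b′ →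
                 ∃ λ R → Add R b S × Add R b′ T
Remove-commute {b = i , j} {i′ , j′} {S} {T} u a i≢i′
  with delete S i j (trans (sym (row-rest a i i≢i′)) (row-new u))
                    (trans (sym (col-rest a j (Remove-columns u a i≢i′))) (col-new u))
... | R , d = R , d , record
  { row-old = trans (sym (row-rest d i′ i′≢i)) (row-old a)
  ; col-old = trans (sym (col-rest d j′ j′≢j)) (col-old a)
  ; row-new = trans (sym (row-rest u i′ i′≢i)) (row-new a)
  ; col-new = trans (sym (col-rest u j′ j′≢j)) (col-new a)
  ; row-rest = rows ; col-rest = columns }
  where
  i′≢i = ≢-sym i≢i′
  j′≢j = ≢-sym (Remove-columns u a i≢i′)
  rows : ∀ k → k ≢ i′ → rowLen T k ≡ rowLen R k
  rows k k≢i′ with k ≟ i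
  ... | yes refl = trans (row-old u) (sym (row-old d))
  ... | no  k≢i  = trans (sym (row-rest u k k≢i)) (trans (row-rest a k k≢i′) (row-rest d k k≢i))
  columns : ∀ k → k ≢ j′ → colLen T k ≡ colLen R k
  columns k k≢j′ with k ≟ j
  ... | yes refl = trans (col-old u) (sym (col-old d))
  ... | no  k≢j  = trans (sym (col-rest u k k≢j)) (trans (col-rest a k k≢j′) (col-rest d k k≢j))

-- Fomin's rule on a cell with corners `ρ` (lower left), `ν` (lower right), `μ` (upper left) and `κ`
-- (upper right): `one` adds a box to the first row, `cross` commutes two additions, `bump` moves on
-- to the next row. `flip-backward` is the inverse.
flip-forward : ∀ {ρ a μ b ν e s t} → Step ρ b ν → Step ρ a μ → Local (rowOf a) (rowOf b) e s t →
               ∃₂ λ a′ b′ → ∃ λ κ → rowOf a′ ≡ s × rowOf b′ ≡ t × Step ν a′ κ × Step μ b′ κ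
flip-forward {ρ} (stay p) (stay q) empty =
  _ , _ , ρ , refl , refl , stay (≈-sym p) , stay (≈-sym q)
flip-forward {ρ} (stay p) (stay q) one with insert-row-0 ρ
... | j , κ , a = _ , _ , κ , refl , refl , add (Add-resp p ≈-refl a) , add (Add-resp q ≈-refl a)
flip-forward {μ = μ} (stay p) (add a) left =
  _ , _ , μ , refl , refl , add (Add-resp p ≈-refl a) , stay ≈-refl
flip-forward {ν = ν} (add b) (stay q) bottom =
  _ , _ , ν , refl , refl , stay ≈-refl , add (Add-resp q ≈-refl b)
flip-forward (add b) (add a) (cross k≢l) with Add-commute a b k≢l
... | κ , u , v = _ , _ , κ , refl , refl , add u , add v
flip-forward (add {k , _} b) (add {.k , _} a) bump
  -- Both boxes lie in row `k` of `ρ`, hence in the same column, and `μ` and `ν` agree up to `_≈_`.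
  with refl ← trans (sym (row-old a)) (row-old b) | insert-next-row a
... | j , κ , u = _ , _ , κ , refl , refl , add (Add-resp (Add-functional ≈-refl a b) ≈-refl u) , add u

flip-backward : ∀ {ν a′ κ μ b′ l m e} → Step ν a′ κ → Step μ b′ κ → Local l m e (rowOf a′) (rowOf b′) →
                ∃₂ λ a b → ∃ λ ρ → rowOf a ≡ l × rowOf b ≡ m × Step ρ b ν × Step ρ a μ
flip-backward {κ = κ} (stay p) (stay q) empty =
  _ , _ , κ , refl , refl , stay (≈-sym p) , stay (≈-sym q)
flip-backward {ν} (add {_ , _} a) (add {_ , _} b) one
  with refl ← suc-injective (trans (sym (row-new a)) (row-new b)) =
  nothing , nothing , ν , refl , refl , stay ≈-refl , stay (Add-injective ≈-refl a b)
flip-backward {ν} (add a) (stay q) left =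
  just _ , nothing , ν , refl , refl , stay ≈-refl , add (Add-resp ≈-refl (≈-sym q) a)
flip-backward {μ = μ} (stay p) (add b) bottom =
  nothing , just _ , μ , refl , refl , add (Add-resp ≈-refl (≈-sym p) b) , stay ≈-refl
flip-backward (add a) (add b) (cross k≢l) with Remove-commute a b k≢l
... | ρ , u , v = _ , _ , ρ , refl , refl , add v , add u
flip-backward (add {_ , _} a) (add {_ , _} b) bump
  with refl ← suc-injective (trans (sym (row-new a)) (row-new b)) | delete-previous-row a
... | j , ρ , u =
  just _ , just _ , ρ , refl , refl , add u , add (Add-resp ≈-refl (Add-injective ≈-refl a b) u)

-- Walks in Young's lattice along the boundary.

data Ups : State → List (Maybe Box) → State → Set where
  []  : ∀ {S T} → S ≈ T → Ups S [] T
  _∷_ : ∀ {S b S₁ bs T} → Step S b S₁ → Ups S₁ bs T → Ups S (b ∷ bs) T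

Ups-respˡ : ∀ {S S′ bs T} → S ≈ S′ → Ups S bs T → Ups S′ bs T
Ups-respˡ p ([] q)  = [] (≈-trans (≈-sym p) q)
Ups-respˡ p (s ∷ u) = Step-resp p ≈-refl s ∷ u

Ups-transpose : ∀ {S bs T} → Ups S bs T → Ups (transpose S) (map transposeBox bs) (transpose T)
Ups-transpose ([] (p , q)) = [] (q , p)
Ups-transpose (s ∷ u)      = Step-transpose s ∷ Ups-transpose u

Ups-functional : ∀ {S S′ bs bs′ T T′} → S ≈ S′ → Ups S bs T → Ups S′ bs′ T′ →
                 map rowOf bs ≡ map rowOf bs′ → bs ≡ bs′ × T ≈ T′
Ups-functional p ([] q)  ([] q′)   _  = refl , ≈-trans (≈-sym q) (≈-trans p q′)
Ups-functional p (s ∷ u) (s′ ∷ u′) eq with ∷-injective eq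
... | eq₁ , eq₂ with Step-functional p s s′ eq₁
... | refl , p₁ with Ups-functional p₁ u u′ eq₂
... | refl , p₂ = refl , p₂

Ups-split : ∀ {S bs T} xs {ys} → Ups S bs T → map rowOf bs ≡ xs ++ ys →
            ∃₂ λ bs₁ bs₂ → ∃ λ S₁ → map rowOf bs₁ ≡ xs × map rowOf bs₂ ≡ ys ×
            Ups S bs₁ S₁ × Ups S₁ bs₂ T
Ups-split []       u       eq = _ , _ , _ , refl , eq , [] ≈-refl , u
Ups-split (x ∷ xs) (s ∷ u) eq with ∷-injective eq
... | eq₁ , eq₂ with Ups-split xs u eq₂
... | bs₁ , bs₂ , S₁ , p , q , u₁ , u₂ = _ ∷ bs₁ , bs₂ , S₁ , cong₂ _∷_ eq₁ p , q , s ∷ u₁ , u₂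

total : ℕ → List Label → ℕ
total k []       = 0
total k (l ∷ ls) = ind k l + total k ls

Ups-count : ∀ {S bs T} k → Ups S bs T → rowLen T k ≡ total k (map rowOf bs) + rowLen S k
Ups-count k ([] (p , _)) = sym (p k)
Ups-count {S} k (_∷_ {b = b} {bs = bs} s u) = begin
  _                                                    ≡⟨ Ups-count k u ⟩
  total k (map rowOf bs) + _                           ≡⟨ cong (total k (map rowOf bs) +_) (Step-count k s) ⟩
  total k (map rowOf bs) + (ind k (rowOf b) + rowLen S k)   ≡⟨ +-assoc (total k (map rowOf bs)) _ _ ⟨
  total k (map rowOf bs) + ind k (rowOf b) + rowLen S k
    ≡⟨ cong (_+ rowLen S k) (+-comm (total k (map rowOf bs)) _) ⟩
  ind k (rowOf b) + total k (map rowOf bs) + rowLen S k     ∎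
  where open ≡-Reasoning

-- A labelling of the boundary of a Ferrers shape, read from the bottom
-- right to the top left: turn w t us continues w by a step to the left
-- with label t and steps upwards with labels us.
data Boundary (A : Set) : Set where
  end  : List A → Boundary A
  turn : Boundary A → A → List A → Boundary A

mapB : ∀ {A B : Set} → (A → B) → Boundary A → Boundary B
mapB f (end us)     = end (map f us)
mapB f (turn w t us) = turn (mapB f w) (f t) (map f us)

end-injective : ∀ {A : Set} {us vs : List A} → end us ≡ end vs → us ≡ vs
end-injective refl = refl

turn-injective : ∀ {A : Set} {w w′ : Boundary A} {t t′ us us′} → turn w t us ≡ turn w′ t′ us′ →
                w ≡ w′ × t ≡ t′ × us ≡ us′
turn-injective refl = refl , refl , refl

-- The list collects the partitions at the top right corners of the columns.
data Walk : Boundary (Maybe Box) → State → List State → Set where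
  end  : ∀ {bs S} → Ups ∅ bs S → Walk (end bs) S []
  turn : ∀ {w S Ss T t us U} → Walk w S Ss → Step T t S → Ups T us U → Walk (turn w t us) U (S ∷ Ss)

Walk-transpose : ∀ {w S Ss} → Walk w S Ss →
                 Walk (mapB transposeBox w) (transpose S) (map transpose Ss)
Walk-transpose (end u)     = end (Ups-transpose u)
Walk-transpose (turn w s u) = turn (Walk-transpose w) (Step-transpose s) (Ups-transpose u)

-- The walk starts at `∅`, and each label forces the next partition: an upward step is determined by
-- its lower end, a step to the left by its right end.
Walk-functional : ∀ {w w′ S S′ Ss Ss′} → Walk w S Ss → Walk w′ S′ Ss′ → mapB rowOf w ≡ mapB rowOf w′ →
                  w ≡ w′ × S ≈ S′ × Pointwise _≈_ Ss Ss′
Walk-functional (end u) (end u′) eq with Ups-functional ≈-refl u u′ (end-injective eq)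
... | refl , p = refl , p , []
Walk-functional (turn w s u) (turn w′ s′ u′) eq with turn-injective eq
... | eq₁ , eq₂ , eq₃ with Walk-functional w w′ eq₁
... | refl , p , ps with Step-injective p s s′ eq₂
... | refl , q with Ups-functional q u u′ eq₃
... | refl , q′ = refl , q′ , p ∷ ps

-- Recovering a filling from a boundary walk.

data Column : ∀ {h} → Vec Bool h → List Label → Label → List Label → Label → Set where
  []  : ∀ {b} → Column [] [] b [] b
  _∷_ : ∀ {h e l b r t ls rs u} {es : Vec Bool h} → Local l b e r t → Column es ls t rs u →
        Column (e ∷ es) (l ∷ ls) b (r ∷ rs) u

-- Inverts the cells from the top down: `bs` and `bs′` are the right and left side of the column,
-- `t` and `b` its top and bottom edge, and the entries are read off from the outgoing labels.
column-backward : ∀ {ν bs μ t κ} → Ups ν bs κ → Step μ t κ →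
  ∃ λ (v : Vec Bool (length bs)) → ∃ λ bs′ → ∃₂ λ b ρ →
  Column v (map rowOf bs′) (rowOf b) (map rowOf bs) (rowOf t) × Step ρ b ν × Ups ρ bs′ μ ×
  length bs′ ≡ length bs
column-backward ([] p) s = [] , [] , _ , _ , [] , Step-resp ≈-refl (≈-sym p) s , [] ≈-refl , refl
column-backward {bs = a ∷ _} (s₁ ∷ u) s with column-backward u s
... | v , bs′ , b , ρ , C , s₂ , u₂ , eq with Local-total (rowOf a) (rowOf b)
... | _ , _ , e , L with flip-backward s₁ s₂ L
... | a′ , b′ , ρ′ , refl , refl , s₃ , s₄ =
  e ∷ v , a′ ∷ bs′ , b′ , ρ′ , L ∷ C , s₃ , s₄ ∷ u₂ , cong suc eq

Step-into-∅ : ∀ {S b} → Step S b ∅ → b ≡ nothing × S ≈ ∅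
Step-into-∅ (stay p) = refl , p
Step-into-∅ (add a) with () ← row-new a

seg : (ℕ → Label) → ℕ → ℕ → List Label
seg g a zero    = []
seg g a (suc d) = g a ∷ seg g (suc a) d

length-seg : ∀ g a d → length (seg g a d) ≡ d
length-seg g a zero    = refl
length-seg g a (suc d) = cong suc (length-seg g (suc a) d)

seg-split : ∀ g a {h n} → h ≤ n → seg g a n ≡ seg g a h ++ seg g (h + a) (n ∸ h)
seg-split g a {zero}          z≤n       = refl
seg-split g a {suc h} {suc n} (s≤s h≤n) rewrite sym (+-suc h a) =
  cong (g a ∷_) (seg-split g (suc a) h≤n)

seg-unsplit : ∀ {g a us} n ls → ls ++ us ≡ seg g a n →
              ls ≡ seg g a (length ls) × us ≡ seg g (length ls + a) (n ∸ length ls)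
seg-unsplit n       []       eq = refl , eq
seg-unsplit {a = a} (suc n) (l ∷ ls) eq with ∷-injective eq
... | refl , eq₂ with seg-unsplit n ls eq₂
... | p , q rewrite sym (+-suc (length ls) a) = cong (l ∷_) p , q

seg-injective : ∀ {g g′ a} d → seg g a d ≡ seg g′ a d → ∀ y → a ≤ y → y < d + a → g y ≡ g′ y
seg-injective zero eq y a≤y y<a = contradiction y<a (≤⇒≯ a≤y)
seg-injective {a = a} (suc d) eq y a≤y y<d with ∷-injective eq | m≤n⇒m<n∨m≡n a≤y
... | eq₁ , _   | inj₂ refl = eq₁
... | _   , eq₂ | inj₁ a<y  = seg-injective d eq₂ y a<y (subst (y <_) (sym (+-suc d a)) y<d)

data Descending : ℕ → Shape → Set where
  []  : ∀ {n} → Descending n []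
  _∷_ : ∀ {n h hs} → h ≤ n → Descending h hs → Descending n (h ∷ hs)

-- The labels on the boundary from the bottom right of the columns hs, the
-- first of which has index c, to the point at height n on its left.
path : (V H : ℕ → ℕ → Label) → Shape → ℕ → ℕ → Boundary Label
path V H []       c n = end (seg (V c) 0 n)
path V H (h ∷ hs) c n = turn (path V H hs (suc c) h) (H c h) (seg (V c) h (n ∸ h))

-- Keeps only the numbers of vertical steps in the boundary. They survive transposition, so
-- `backward` applies to the transposed walk.
data Fits {A : Set} : Boundary A → Shape → ℕ → Set where
  end  : ∀ {us n} → length us ≡ n → Fits (end us) [] n
  turn : ∀ {w t us h hs n} → h + length us ≡ n → Fits w hs h → Fits (turn w t us) (h ∷ hs) n

path-fits : ∀ {V H c n hs} → Descending n hs → Fits (path V H hs c n) hs n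
path-fits []                    = end (length-seg _ 0 _)
path-fits (_∷_ {h = h} h≤n hs↓) =
  turn (trans (cong (h +_) (length-seg _ h _)) (m+[n∸m]≡n h≤n)) (path-fits hs↓)

Fits-map : ∀ {A B : Set} (f : A → B) {w hs n} → Fits w hs n → Fits (mapB f w) hs n
Fits-map f (end {us} p)                = end (trans (length-map f us) p)
Fits-map f (turn {us = us} {h = h} p F) = turn (trans (cong (h +_) (length-map f us)) p) (Fits-map f F)

Fits-unmap : ∀ {A B : Set} (f : A → B) w {hs n} → Fits (mapB f w) hs n → Fits w hs n
Fits-unmap f (end us)      (end p)            = end (trans (sym (length-map f us)) p)
Fits-unmap f (turn w t us) (turn {h = h} p F) =
  turn (trans (cong (h +_) (sym (length-map f us))) p) (Fits-unmap f w F)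

-- The list holds the labels on the line left of `f`; its part `us` above the first column lies on
-- the boundary itself.
data Fill : ∀ {hs} → Filling hs → List Label → Boundary Label → Set where
  []   : ∀ {ls} → Fill [] ls (end ls)
  turn : ∀ {h hs} {v : Vec Bool h} {f : Filling hs} {ls rs t us w} →
         Column v ls nothing rs t → Fill f rs w → Fill (v ∷ f) (ls ++ us) (turn w t us)

Ups-++ : ∀ {S bs T bs′ U} → Ups S bs T → Ups T bs′ U → Ups S (bs ++ bs′) U
Ups-++ ([] p)  u′ = Ups-respˡ (≈-sym p) u′
Ups-++ (s ∷ u) u′ = s ∷ Ups-++ u u′

-- Sweeps the columns from right to left. The line left of a column consists of the side found by
-- `column-backward` and, above it, the vertical steps of the walk.
backward : ∀ {w S Ss hs n} → Walk w S Ss → Fits w hs n →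
           ∃₂ λ (f : Filling hs) bs → length bs ≡ n × Fill f (map rowOf bs) (mapB rowOf w) × Ups ∅ bs S
backward (end u) (end p) = [] , _ , p , [] , u
backward (turn {us = us} W s u) (turn p F) with backward W F
... | f , bs , refl , fill , u₁ with column-backward u₁ s
... | v , bs′ , b , ρ , C , s₂ , u₂ , eq with Step-into-∅ s₂
-- No box can be added to reach `∅`, so the bottom edge is unlabelled and the next line starts at
-- `∅` again.
... | refl , ρ≈∅ =
  v ∷ f , bs′ ++ us , trans (length-++ bs′) (trans (cong (_+ length us) eq) p) ,
  subst (λ ls → Fill _ ls _) (sym (map-++ rowOf bs′ us)) (turn C fill) ,
  Ups-++ (Ups-respˡ ρ≈∅ u₂) u

-- Upward steps never remove boxes. For a closed walk this makes the left side of the shape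
-- unlabelled.
Ups-into-empty : ∀ {bs S} → Ups ∅ bs S → (∀ k → rowLen S k ≡ 0) →
                 map rowOf bs ≡ seg (λ _ → nothing) 0 (length bs)
Ups-into-empty {bs} u S≡∅ = all-nothing 0 (map rowOf bs) (length-map rowOf bs)
  λ k → trans (sym (trans (Ups-count k u) (+-identityʳ _))) (S≡∅ k)
  where
  all-nothing : ∀ {n} a ls → length ls ≡ n → (∀ k → total k ls ≡ 0) → ls ≡ seg (λ _ → nothing) a n
  all-nothing a []             refl p = refl
  all-nothing a (nothing ∷ ls) refl p = cong (nothing ∷_) (all-nothing (suc a) ls refl p)
  all-nothing a (just k ∷ ls)  refl p with () ← trans (sym (cong (_+ total k ls) (ind-same k))) (p k)

Column-length : ∀ {h} {v : Vec Bool h} {ls b rs t} → Column v ls b rs t → length ls ≡ h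
Column-length []      = refl
Column-length (_ ∷ C) = cong suc (Column-length C)

-- Recognising given labels as those computed from the entries.

module Reading (e : ℕ → ℕ → Bool) where
  open Diagram e

  Incoming : ℕ → ℕ → Set
  Incoming c y = V c y ≡ nothing × H c y ≡ nothing

  read-column : ∀ {h} {v : Vec Bool h} {ls b rs t} c y → Column v ls b rs t →
    ls ≡ seg (V c) y h → b ≡ H c y → (∀ i → e c (i + y) ≡ entryV v i) →
    rs ≡ seg (V (suc c)) y h × t ≡ H c (h + y) × (∀ i → e c (i + y) ≡ true → Incoming c (i + y))
  read-column c y [] eq b≡ entries =
    refl , b≡ , λ i p → contradiction (trans (sym (entries i)) p) λ ()
  read-column {suc h} c y (L ∷ C) eq refl entries with ∷-injective eq | entries 0
  ... | refl , eq₂ | refl with Local-fwd L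
  ... | refl with read-column c (suc y) C eq₂ refl (λ i → trans (cong (e c) (+-suc i y)) (entries (suc i)))
  ... | p , q , g = cong (_ ∷_) p , trans q (cong (H c) (+-suc h y)) , incoming
    where
    incoming : ∀ i → e c (i + y) ≡ true → Incoming c (i + y)
    incoming zero    = Local-entry L
    incoming (suc i) = subst (λ z → e c z ≡ true → Incoming c z) (+-suc i y) (g i)

  -- `Local` determines outgoing labels, so agreement on the left line propagates through the
  -- columns; each one met on the way has unlabelled incoming edges.
  read-fill : ∀ {hs} {f : Filling hs} {ls w} c n → Fill f ls w → ls ≡ seg (V c) 0 n →
    (∀ i y → e (i + c) y ≡ entry f (i , y)) →
    w ≡ path V H hs c n × (∀ i y → e (i + c) y ≡ true → Incoming (i + c) y)
  read-fill c n [] eq entries =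
    cong end eq , λ i y p → contradiction (trans (sym (entries i y)) p) λ ()
  read-fill c n (turn {h} {ls = ls} C F) eq entries with seg-unsplit n ls eq
  ... | p , q rewrite Column-length C | +-identityʳ h
    with read-column c 0 C p refl (λ i → trans (cong (e c) (+-identityʳ i)) (entries 0 i))
  ... | p′ , q′ , g rewrite +-identityʳ h
    with read-fill (suc c) h F p′ (λ i y → trans (cong (λ x → e x y) (+-suc i c)) (entries (suc i) y))
  ... | refl , g′ = cong₂ (λ t us → turn _ t us) q′ q , incoming
    where
    incoming : ∀ i y → e (i + c) y ≡ true → Incoming (i + c) y
    incoming zero    y = subst (λ z → e c z ≡ true → Incoming c z) (+-identityʳ y) (g y)
    incoming (suc i) y = subst (λ x → e x y ≡ true → Incoming x y) (+-suc i c) (g′ i y)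

-- From a filling to its boundary walk.

module Forward (e : ℕ → ℕ → Bool) (V H : ℕ → ℕ → Label)
  (V-boundary : ∀ y → V 0 y ≡ nothing) (H-boundary : ∀ c → H c 0 ≡ nothing)
  (local : ∀ c y → Local (V c y) (H c y) (e c y) (V (suc c) y) (H c (suc y))) where

  open Growth e V H V-boundary H-boundary local

  column-forward : ∀ c y d {ρ b ν bs μ} → Step ρ b ν → rowOf b ≡ H c y →
    Ups ρ bs μ → map rowOf bs ≡ seg (V c) y d →
    ∃₂ λ bs′ t → ∃ λ κ → map rowOf bs′ ≡ seg (V (suc c)) y d × rowOf t ≡ H c (d + y) ×
                         Ups ν bs′ κ × Step μ t κ
  column-forward c y zero s b≡ ([] p) eq = [] , _ , _ , refl , b≡ , [] ≈-refl , Step-resp p ≈-refl s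
  column-forward c y (suc d) s b≡ (s₁ ∷ u) eq with ∷-injective eq
  ... | eq₁ , eq₂ with flip-forward s s₁ (subst₂ (λ l b → Local l b _ _ _) (sym eq₁) (sym b≡) (local c y))
  ... | a′ , b′ , κ , p , q , s₂ , s₃ with column-forward c (suc y) d s₃ q u eq₂
  ... | bs′ , t , κ′ , p′ , q′ , u′ , s′ =
    a′ ∷ bs′ , t , κ′ , cong₂ _∷_ p p′ , trans q′ (cong (H c) (+-suc d y)) , s₂ ∷ u′ , s′

  total-seg : ∀ k c y d → total k (seg (V c) y d) + count k c y ≡ count k c (d + y)
  total-seg k c y zero    = refl
  total-seg k c y (suc d) = begin
    ind k (V c y) + total k (seg (V c) (suc y) d) + count k c y
      ≡⟨ cong (_+ count k c y) (+-comm (ind k (V c y)) _) ⟩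
    total k (seg (V c) (suc y) d) + ind k (V c y) + count k c y
      ≡⟨ +-assoc (total k (seg (V c) (suc y) d)) _ _ ⟩
    total k (seg (V c) (suc y) d) + count k c (suc y)             ≡⟨ total-seg k c (suc y) d ⟩
    count k c (d + suc y)                                         ≡⟨ cong (count k c) (+-suc d y) ⟩
    count k c (suc d + y)                                         ∎
    where open ≡-Reasoning

  data Corners : Shape → ℕ → List State → Set where
    []  : ∀ {c} → Corners [] c []
    _∷_ : ∀ {c h hs S Ss} → (∀ k → rowLen S k ≡ count k (suc c) h) → Corners hs (suc c) Ss →
          Corners (h ∷ hs) c (S ∷ Ss)

  forward : ∀ {hs n S bs} c → Descending n hs → Ups ∅ bs S → map rowOf bs ≡ seg (V c) 0 n →
            ∃₂ λ w Ss → mapB rowOf w ≡ path V H hs c n × Walk w S Ss × Corners hs c Ss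
  forward c [] u eq = _ , _ , cong end eq , end u , []
  forward {h ∷ hs} {n} c (h≤n ∷ hs↓) u eq
    -- Only the lowest `h` steps border the column; the others belong to the boundary.
    with Ups-split (seg (V c) 0 h) u (trans eq (seg-split (V c) 0 h≤n))
  ... | bs₁ , bs₂ , S₁ , p₁ , p₂ , u₁ , u₂
    with column-forward c 0 h (stay ≈-refl) (sym (H-boundary c)) u₁ p₁
  ... | bs′ , t , κ , p′ , q′ , u′ , s′ with forward (suc c) hs↓ u′ p′
  ... | w , Ss , eqw , W , cs = turn w t bs₂ , κ ∷ Ss , eq′ , turn W s′ u₂ , κ-count ∷ cs
    where
    eq′ : turn (mapB rowOf w) (rowOf t) (map rowOf bs₂) ≡ path V H (h ∷ hs) c n
    eq′ rewrite eqw | q′ | p₂ | +-identityʳ h = refl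
    κ-count : ∀ k → rowLen κ k ≡ count k (suc c) h
    κ-count k = begin
      rowLen κ k                                                ≡⟨ Ups-count k u′ ⟩
      total k (map rowOf bs′) + 0                          ≡⟨ cong (λ ls → total k ls + 0) p′ ⟩
      total k (seg (V (suc c)) 0 h) + count k (suc c) 0    ≡⟨ total-seg k (suc c) 0 h ⟩
      count k (suc c) (h + 0)                              ≡⟨ cong (count k (suc c)) (+-identityʳ h) ⟩
      count k (suc c) h                                    ∎
      where open ≡-Reasoning

  NE-max : ∀ {S c y} → (∀ k → rowLen S k ≡ count k c y) → NE (Level 0) c y (rowLen S 0)
  NE-max {c = c} {y} p = subst (NE _ c y) (sym (p 0)) (count⇒NE c y)

  NE-bound : ∀ {S c y k} → (∀ k → rowLen S k ≡ count k c y) → NE (Level 0) c y k → k ≤ rowLen S 0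
  NE-bound p n = ≤-trans (NE≤count n) (≤-reflexive (sym (p 0)))

  -- If the first column has length `suc m`, row `m` is nonempty, and `count⇒SE` supplies the chain.
  SE-max : ∀ {c y} S → (∀ k → rowLen S k ≡ count k c y) → SE (Level 0) c 0 y (colLen S 0)
  SE-max S p with colLen S 0 in eq
  ... | zero  = nil
  ... | suc m = count⇒SE m (subst (0 <_) (p m) (col⇒row S (subst (m <_) (sym eq) (n<1+n m))))

  SE-bound : ∀ {c y k} S → (∀ k → rowLen S k ≡ count k c y) → SE (Level 0) c 0 y k → k ≤ colLen S 0
  SE-bound {k = zero}  S p n = z≤n
  SE-bound {k = suc m} S p n = row⇒col S (subst (0 <_) (sym (p m)) (SE⇒count m n))

-- The boundary labels determine the filling.

module Comparison
  {e e′ : ℕ → ℕ → Bool} {V H V′ H′ : ℕ → ℕ → Label}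
  (local  : ∀ c y → Local (V c y) (H c y) (e c y) (V (suc c) y) (H c (suc y)))
  (local′ : ∀ c y → Local (V′ c y) (H′ c y) (e′ c y) (V′ (suc c) y) (H′ c (suc y))) where

  -- From the top down: the outgoing labels of a cell fix its entry, its left label and its bottom
  -- label, which is the top label of the cell below.
  column-injective : ∀ c h → (∀ y → y < h → V (suc c) y ≡ V′ (suc c) y) → H c h ≡ H′ c h →
                     ∀ y → y < h → V c y ≡ V′ c y × e c y ≡ e′ c y
  column-injective c (suc h) p q y (s≤s y≤h)
    with Local-injective (local c h) (subst₂ (Local _ _ _) (sym (p h (n<1+n h))) (sym q) (local′ c h))
       | m≤n⇒m<n∨m≡n y≤h
  ... | eqV , _   , eqe | inj₂ refl = eqV , eqe
  ... | _   , eqH , _   | inj₁ y<h  = column-injective c h (λ z z<h → p z (m<n⇒m<1+n z<h)) eqH y y<h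

  path-injective : ∀ {hs} c n → Descending n hs → path V H hs c n ≡ path V′ H′ hs c n →
    (∀ y → y < n → V c y ≡ V′ c y) ×
    (∀ i y → i < length hs → y < height hs i → e (i + c) y ≡ e′ (i + c) y)
  path-injective c n [] eq =
    (λ y y<n → seg-injective n (end-injective eq) y z≤n (subst (y <_) (sym (+-identityʳ n)) y<n)) , λ _ _ ()
  path-injective {h ∷ hs} c n (h≤n ∷ hs↓) eq with turn-injective eq
  ... | eq₁ , eq₂ , eq₃ with path-injective (suc c) h hs↓ eq₁
  ... | p , q = labels , entries
    where
    labels : ∀ y → y < n → V c y ≡ V′ c y
    labels y y<n with h ≤? y
    ... | yes h≤y = seg-injective (n ∸ h) eq₃ y h≤y (subst (y <_) (sym (m∸n+n≡m h≤n)) y<n)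
    ... | no  h≰y = proj₁ (column-injective c h p eq₂ y (≰⇒> h≰y))
    entries : ∀ i y → i < suc (length hs) → y < height (h ∷ hs) i → e (i + c) y ≡ e′ (i + c) y
    entries zero    y _         y<h = proj₂ (column-injective c h p eq₂ y y<h)
    entries (suc i) y (s≤s i<m) y<h = subst (λ x → e x y ≡ e′ x y) (+-suc i c) (q i y i<m y<h)

-- Labelled edges, shapes and entries.

weight : ∀ {A : Set} → Maybe A → ℕ
weight nothing  = 0
weight (just _) = 1

-- Counts the labelled top edges of columns, which is the number of ones. Transposition may change a
-- label but not whether an edge has one.
turns : ∀ {A : Set} → Boundary (Maybe A) → ℕ
turns (end us)      = 0
turns (turn w t us) = weight t + turns w

turns-map : ∀ {A B : Set} (f : A → B) w → turns (mapB (Maybe.map f) w) ≡ turns w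
turns-map f (end us)             = refl
turns-map f (turn w nothing us)  = turns-map f w
turns-map f (turn w (just _) us) = cong suc (turns-map f w)

transposeBox-involutive : ∀ b → transposeBox (transposeBox b) ≡ b
transposeBox-involutive nothing  = refl
transposeBox-involutive (just _) = refl

map-involutive : ∀ {A : Set} (f : A → A) → (∀ x → f (f x) ≡ x) → ∀ xs → map f (map f xs) ≡ xs
map-involutive f p []       = refl
map-involutive f p (x ∷ xs) = cong₂ _∷_ (p x) (map-involutive f p xs)

mapB-involutive : ∀ {A : Set} (f : A → A) → (∀ x → f (f x) ≡ x) → ∀ w → mapB f (mapB f w) ≡ w
mapB-involutive f p (end us)      = cong end (map-involutive f p us)
mapB-involutive f p (turn w t us)
  rewrite mapB-involutive f p w | p t | map-involutive f p us = refl

Ferrers⇒Descending : ∀ hs → IsFerrers hs → Descending (height hs 0) hs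
Ferrers⇒Descending []       _       = []
Ferrers⇒Descending (h ∷ hs) (L , _) = ≤-refl ∷ tail hs L
  where
  tail : ∀ {h} hs → Linked _≥_ (h ∷ hs) → Descending h hs
  tail []        [-]       = []
  tail (h′ ∷ hs) (p ∷ L) = p ∷ tail hs L

height-≤ : ∀ {n hs} → Descending n hs → ∀ i → height hs i ≤ n
height-≤ []       i       = z≤n
height-≤ (p ∷ D) zero    = p
height-≤ (p ∷ D) (suc i) = ≤-trans (height-≤ D i) p

height-antitone : ∀ {n hs} → Descending n hs → ∀ {i j} → i ≤ j → height hs j ≤ height hs i
height-antitone []      _               = z≤n
height-antitone (p ∷ D) {zero} {zero} _ = ≤-refl
height-antitone (p ∷ D) {zero} {suc j} _ = height-≤ D j
height-antitone (p ∷ D) (s≤s i≤j)       = height-antitone D i≤j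

entryV-bounded : ∀ {h} (v : Vec Bool h) y → entryV v y ≡ true → y < h
entryV-bounded (b ∷ v) zero    p = s≤s z≤n
entryV-bounded (b ∷ v) (suc y) p = s≤s (entryV-bounded v y p)

One⇒∈F : ∀ {hs} (f : Filling hs) x → One f x → x ∈F hs
One⇒∈F (v ∷ f) (zero  , y) p = s≤s z≤n , entryV-bounded v y p
One⇒∈F (v ∷ f) (suc c , y) p with One⇒∈F f (c , y) p
... | c<m , y<h = s≤s c<m , y<h

entryV-ext : ∀ {h} (u v : Vec Bool h) → (∀ y → y < h → entryV u y ≡ entryV v y) → u ≡ v
entryV-ext []      []      p = refl
entryV-ext (a ∷ u) (b ∷ v) p =
  cong₂ _∷_ (p 0 (s≤s z≤n)) (entryV-ext u v λ y y<h → p (suc y) (s≤s y<h))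

entry-ext : ∀ {hs} (f g : Filling hs) →
            (∀ i y → i < length hs → y < height hs i → entry f (i , y) ≡ entry g (i , y)) → f ≡ g
entry-ext []      []      p = refl
entry-ext (u ∷ f) (v ∷ g) p =
  cong₂ _∷_ (entryV-ext u v λ y → p 0 y (s≤s z≤n)) (entry-ext f g λ i y i<m → p (suc i) y (s≤s i<m))

-- Chains as lists of cells.

Beyond : ℕ → ℕ → List Cell → Set
Beyond c y []      = ⊤
Beyond c y (x ∷ _) = c ≤ col x × y ≤ row x

module _ {hs} (f : Filling hs) where

  -- `NE` exposes the last cell and a list the first, so the part already converted is accumulated
  -- in `ys`; `Beyond` lets it follow the rest.
  NE⇒list : ∀ {c y k} → NE (λ x z → One f (x , z)) c y k → ∀ ys → IsNEChain f ys → Beyond c y ys →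
            ∃ λ xs → IsNEChain f xs × length xs ≡ k + length ys
  NE⇒list nil ys C _ = ys , C , refl
  NE⇒list (snoc {k = k} x z x<c z<y a n) ys (A , L) B
    with NE⇒list n ((x , z) ∷ ys) (a ∷ A , link ys L B) (≤-refl , ≤-refl)
    where
    link : ∀ ys → Linked NEstep ys → Beyond _ _ ys → Linked NEstep ((x , z) ∷ ys)
    link []       _ _       = [-]
    link (y ∷ ys) L (p , q) = (<-≤-trans x<c p , <-≤-trans z<y q) ∷ L
  ... | xs , C , eq = xs , C , trans eq (+-suc k (length ys))

  list⇒NE : ∀ x xs {k} → NE (λ x z → One f (x , z)) (col x) (row x) k → IsNEChain f (x ∷ xs) →
            NE (λ x z → One f (x , z)) (suc (col (lastCell x xs))) (suc (row (lastCell x xs)))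
               (suc (length xs + k))
  list⇒NE x []       n (a ∷ _ , _) = snoc _ _ (n<1+n _) (n<1+n _) a n
  list⇒NE x (y ∷ ys) {k} n (a ∷ A , (p , q) ∷ L) =
    subst (NE _ _ _) (cong suc (+-suc (length ys) k)) (list⇒NE y ys (snoc _ _ p q a n) (A , L))

  last-One : ∀ x xs → All (One f) (x ∷ xs) → One f (lastCell x xs)
  last-One x []       (a ∷ _) = a
  last-One x (y ∷ ys) (_ ∷ A) = last-One y ys A

  SE⇒list : ∀ {c lo y k} → SE (λ x z → One f (x , z)) c lo y (suc k) →
            ∃₂ λ x xs → All (One f) (x ∷ xs) × Linked SEstep (x ∷ xs) × length xs ≡ k ×
                        lo ≤ col x × row x < y × col (lastCell x xs) < c
  SE⇒list (cons x z p q s a nil) = (x , z) , [] , a ∷ [] , [-] , refl , p , s , q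
  SE⇒list (cons x z p q s a n@(cons _ _ _ _ _ _ _)) with SE⇒list n
  ... | x′ , xs , A , L , eq , p′ , s′ , q′ =
    (x , z) , x′ ∷ xs , a ∷ A , (p′ , s′) ∷ L , cong suc eq , p , s , q′

  last-right : ∀ x xs → Linked SEstep (x ∷ xs) → col x ≤ col (lastCell x xs)
  last-right x []       _             = ≤-refl
  last-right x (y ∷ ys) ((p , _) ∷ L) = ≤-trans (<⇒≤ p) (last-right y ys L)

  list⇒SE : ∀ {c lo y} x xs → All (One f) (x ∷ xs) → Linked SEstep (x ∷ xs) →
            col (lastCell x xs) < c → lo ≤ col x → row x < y →
            SE (λ x z → One f (x , z)) c lo y (suc (length xs))
  list⇒SE x []       (a ∷ _) _ q p s = cons _ _ p q s a nil
  list⇒SE x (y ∷ ys) (a ∷ A) L@((p′ , s′) ∷ L′) q p s =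
    cons _ _ p (≤-<-trans (last-right x (y ∷ ys) L) q) s a (list⇒SE y ys A L′ q p′ s′)

-- The attaining chain may end in any column; only the upper bound refers to column `i`. Thus `a` is
-- the maximum for a rectangle that contains all chains ending in column `i`.
Best : (List Cell → Set) → ℕ → ℕ → Set
Best C i a = (∃ λ xs → C xs × length xs ≡ a) ×
             (∀ x xs → C (x ∷ xs) → col (lastCell x xs) ≡ i → length (x ∷ xs) ≤ a)

-- At the column where a longest chain of `C` ends, the common value is at least `s`, and at most
-- `s` because `C` attains it; so `C′` attains `s`. In every other column the value is attained in
-- `C` too, so it bounds `C′` by `s`.
LongestIs-transfer : ∀ {C C′ m s} → 1 ≤ s →
  (∀ x xs → C (x ∷ xs) → col (lastCell x xs) < m) →
  (∀ x xs → C′ (x ∷ xs) → col (lastCell x xs) < m) →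
  (∀ i → i < m → ∃ λ a → Best C i a × Best C′ i a) →
  LongestIs C s → LongestIs C′ s
-- The empty chain has no last column; `1≤s` rules it out.
LongestIs-transfer 1≤s inC inC′ best (([] , _ , eq) , _) =
  contradiction (subst (0 <_) (sym eq) 1≤s) n≮0
LongestIs-transfer {C′ = C′} {s = s} 1≤s inC inC′ best ((x ∷ xs , c , refl) , bound)
  with best _ (inC x xs c)
... | a , ((ys , c₁ , refl) , b) , ((zs , c′ , eq) , _) =
  (zs , c′ , trans eq (≤-antisym (bound ys c₁) (b x xs c refl))) , bound′
  where
  bound′ : ∀ ws → C′ ws → length ws ≤ s
  bound′ []       _ = z≤n
  bound′ (w ∷ ws) d with best _ (inC′ w ws d)
  ... | a , ((ys , c₁ , refl) , _) , (_ , b′) = ≤-trans (b′ w ws d refl) (bound ys c₁)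

module _ {hs} (f : Filling hs) where

  NE-inside : ∀ x xs → IsNEChain f (x ∷ xs) → col (lastCell x xs) < length hs
  NE-inside x xs (A , _) = proj₁ (One⇒∈F f _ (last-One f x xs A))

  SE-inside : ∀ x xs → IsSEChain f (x ∷ xs) → col (lastCell x xs) < length hs
  SE-inside x xs (A , _) = proj₁ (One⇒∈F f _ (last-One f x xs A))

nth : List State → ℕ → State
nth []       _       = ∅
nth (S ∷ _)  zero    = S
nth (_ ∷ Ss) (suc i) = nth Ss i

nth-resp : ∀ {Ss Ts} → Pointwise _≈_ Ss Ts → ∀ i → nth Ss i ≈ nth Ts i
nth-resp []       i       = ≈-refl
nth-resp (p ∷ _)  zero    = p
nth-resp (_ ∷ ps) (suc i) = nth-resp ps i

nth-transpose : ∀ Ss i → nth (map transpose Ss) i ≡ transpose (nth Ss i)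
nth-transpose []       i       = refl
nth-transpose (S ∷ Ss) zero    = refl
nth-transpose (S ∷ Ss) (suc i) = nth-transpose Ss i

Local-weight : ∀ {l b e r t} → Local l b e r t → e ≡ false → weight t ≡ weight b
Local-weight empty     _ = refl
Local-weight left      _ = refl
Local-weight bottom    _ = refl
Local-weight (cross _) _ = refl
Local-weight bump      _ = refl

-- The growth diagram of a filling and its corners.

module OfFilling {hs} (f : Filling hs) where

  entries : ℕ → ℕ → Bool
  entries c y = entry f (c , y)

  open Diagram entries public

  boundary : Boundary Label
  boundary = path V H hs 0 (height hs 0)

  compatible : AtMostOnePerLine f → Compatible
  compatible (columns , rows) = lines⇒compatible
    (λ c c′ y p q → cong col (rows (c , y) (c′ , y) p q refl))
    (λ c y y′ p q → cong row (columns (c , y) (c , y′) p q refl))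

  module _ (compat : Compatible) where

    local : ∀ c y → Local (V c y) (H c y) (entries c y) (V (suc c) y) (H c (suc y))
    local = compatible⇒local compat

    open Growth entries V H (λ _ → refl) (λ _ → refl) local
    open Forward entries V H (λ _ → refl) (λ _ → refl) local

    compatible⇒lines : AtMostOnePerLine f
    compatible⇒lines =
      (λ { (x , y) (.x , y′) p q refl → cong (x ,_) (unique-columns x y y′ p q) }) ,
      (λ { (x , y) (x′ , .y) p q refl → cong (_, y) (unique-rows x x′ y p q) })

    Corner : ℕ → State → Set
    Corner i S = ∀ k → rowLen S k ≡ count k (suc i) (height hs i)

    Best-NE : ∀ {i S} → Corner i S → Best (IsNEChain f) i (rowLen S 0)
    Best-NE {i} {S} corner = chain , bound
      where
      chain : ∃ λ xs → IsNEChain f xs × length xs ≡ rowLen S 0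
      chain with NE⇒list f (NE-map Level-0⇒one (NE-max {S} {suc i} {height hs i} corner)) [] ([] , []) tt
      ... | xs , C , eq = xs , C , trans eq (+-identityʳ _)
      bound : ∀ x xs → IsNEChain f (x ∷ xs) → col (lastCell x xs) ≡ i → length (x ∷ xs) ≤ rowLen S 0
      bound x xs C@(A , _) refl = NE-bound {S} corner (NE-map one⇒Level-0
        (NE-weaken ≤-refl (proj₂ (One⇒∈F f _ (last-One f x xs A)))
          (subst (NE _ _ _) (cong suc (+-identityʳ _)) (list⇒NE f x xs nil C))))

    -- The rectangle condition matches the corner of column `i`. Any chain in the columns up to `i`
    -- and below height `height hs i` satisfies it, since columns further left are at least as high.
    Best-SE : ∀ {n i S} → Descending n hs → i < length hs → Corner i S →
              Best (IsSEChain f) i (colLen S 0)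
    Best-SE {n} {i} {S} D i<m corner = chain (colLen S 0) (SE-map Level-0⇒one (SE-max S corner)) , bound
      where
      chain : ∀ k → SE (λ x z → One f (x , z)) (suc i) 0 (height hs i) k →
              ∃ λ xs → IsSEChain f xs × length xs ≡ k
      chain zero    _ = [] , ([] , [] , tt) , refl
      chain (suc k) s with SE⇒list f s
      ... | x , xs , A , L , eq , _ , x<h , last≤i =
        x ∷ xs , (A , L , rect) , cong suc eq
        where
        rect : RectIn hs x (lastCell x xs)
        rect c y _ c≤last _ y≤x =
          ≤-<-trans c≤i i<m , <-≤-trans (≤-<-trans y≤x x<h) (height-antitone D c≤i)
          where c≤i = ≤-trans c≤last (s≤s⁻¹ last≤i)
      lower-last : ∀ x xs → Linked SEstep (x ∷ xs) → row (lastCell x xs) ≤ row x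
      lower-last x []       _             = ≤-refl
      lower-last x (y ∷ ys) ((_ , p) ∷ L) = ≤-trans (lower-last y ys L) (<⇒≤ p)
      bound : ∀ x xs → IsSEChain f (x ∷ xs) → col (lastCell x xs) ≡ i → length (x ∷ xs) ≤ colLen S 0
      -- Applied to the upper right cell of its rectangle, `rect` puts the first cell, hence the
      -- chain, below the height of column `i`.
      bound x xs (A , L , rect) refl = SE-bound S corner (SE-map one⇒Level-0
        (list⇒SE f x xs A L (n<1+n _) z≤n
          (proj₂ (rect _ _ (last-right f x xs L) ≤-refl (lower-last x xs L) ≤-refl))))

    corners⇒nth : ∀ {hs c Ss} → Corners hs c Ss → ∀ i → i < length hs →
                  ∀ k → rowLen (nth Ss i) k ≡ count k (suc (i + c)) (height hs i)
    corners⇒nth              (p ∷ _)  zero    _         k = p k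
    corners⇒nth {_ ∷ hs} {c} (_ ∷ cs) (suc i) (s≤s i<m) k =
      trans (corners⇒nth cs i i<m k) (cong (λ x → count k (suc x) (height hs i)) (+-suc i c))

    walk : Descending (height hs 0) hs →
           ∃₂ λ w Ss → mapB rowOf w ≡ boundary × Walk w ∅ Ss × (∀ i → i < length hs → Corner i (nth Ss i))
    -- The left side of the shape carries `∅` throughout, so the walk is closed.
    walk D with forward 0 D (idle (height hs 0)) (idle-rows (height hs 0) 0)
      where
      idle : ∀ n → Ups ∅ (replicate n nothing) ∅
      idle zero    = [] ≈-refl
      idle (suc n) = stay ≈-refl ∷ idle n
      idle-rows : ∀ n a → map rowOf (replicate n nothing) ≡ seg (V 0) a n
      idle-rows zero    a = refl
      idle-rows (suc n) a = cong (nothing ∷_) (idle-rows n (suc a))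
    ... | w , Ss , eq , W , cs = w , Ss , eq , W ,
      λ i i<m k → trans (corners⇒nth cs i i<m k) (cong (λ x → count k (suc x) (height hs i)) (+-identityʳ i))

    -- A one turns an unlabelled bottom edge into a labelled top edge; every other cell passes the
    -- weight on.
    ones-column : ∀ {h} (v : Vec Bool h) c y → (∀ i → entries c (i + y) ≡ entryV v i) →
                  weight (H c (h + y)) ≡ onesV v + weight (H c y)
    ones-column [] c y p = refl
    ones-column {suc h} (b ∷ v) c y p = begin
      weight (H c (suc h + y))          ≡⟨ cong (λ z → weight (H c z)) (sym (+-suc h y)) ⟩
      weight (H c (h + suc y))
        ≡⟨ ones-column v c (suc y) (λ i → trans (cong (entries c) (+-suc i y)) (p (suc i))) ⟩
      onesV v + weight (H c (suc y))    ≡⟨ bit b (p 0) ⟩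
      onesV (b ∷ v) + weight (H c y)    ∎
      where
      open ≡-Reasoning
      bit : ∀ b → entries c y ≡ b → onesV v + weight (H c (suc y)) ≡ onesV (b ∷ v) + weight (H c y)
      bit true  q = trans (cong (onesV v +_) (cong weight (proj₂ (Local-one⁺ (local c y) q))))
        (trans (+-comm (onesV v) 1) (cong suc (sym (trans (cong (onesV v +_)
          (cong weight (proj₂ (Local-entry (local c y) q)))) (+-identityʳ _)))))
      bit false q = cong (onesV v +_) (Local-weight (local c y) q)

    ones-turns : ∀ {hs} (g : Filling hs) c n → (∀ i y → entries (i + c) y ≡ entry g (i , y)) →
                 ones g ≡ turns (path V H hs c n)
    ones-turns []          c n p = refl
    ones-turns (_∷_ {h} v g) c n p = cong₂ _+_ column
      (ones-turns g (suc c) h λ i y → trans (cong (λ x → entries x y) (+-suc i c)) (p (suc i) y))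
      where
      column : onesV v ≡ weight (H c h)
      column = begin
        onesV v                  ≡⟨ +-identityʳ _ ⟨
        onesV v + 0              ≡⟨ ones-column v c 0 (λ i → trans (cong (entries c) (+-identityʳ i)) (p 0 i)) ⟨
        weight (H c (h + 0))    ≡⟨ cong (λ z → weight (H c z)) (+-identityʳ h) ⟩
        weight (H c h)          ∎
        where open ≡-Reasoning

    ones-boundary : ones f ≡ turns boundary
    ones-boundary = ones-turns f 0 (height hs 0) λ i y → cong (λ x → entries x y) (+-identityʳ i)

-- The bijection by transposing the boundary walk.

open OfFilling using (boundary; compatible; compatible⇒lines)

-- A symmetric relation instead of a map, so that totality and injectivity on one side give them on
-- the other.
record Dual {hs} (f g : Filling hs) : Set where
  constructor dual
  field
    linesˡ : AtMostOnePerLine f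
    linesʳ : AtMostOnePerLine g
    {steps}  : Boundary (Maybe Box)
    {states} : List State
    walk   : Walk steps ∅ states
    pathˡ  : mapB rowOf steps ≡ boundary f
    pathʳ  : mapB rowOf (mapB transposeBox steps) ≡ boundary g
open Dual

transpose-twice : ∀ w → mapB transposeBox (mapB transposeBox w) ≡ w
transpose-twice = mapB-involutive transposeBox transposeBox-involutive

Dual-sym : ∀ {hs} {f g : Filling hs} → Dual f g → Dual g f
Dual-sym (dual a b {w} W p q) =
  dual b a (Walk-transpose W) q (trans (cong (mapB rowOf) (transpose-twice w)) p)

module _ {hs} (D : Descending (height hs 0) hs) where

  -- The transposed walk is again closed, so `backward` yields a filling `g` with unlabelled left
  -- side, and `read-fill` identifies the labels with those of the diagram of `g`.
  Dual-total : (f : Filling hs) → AtMostOnePerLine f → ∃ λ g → Dual f g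
  Dual-total f lines with OfFilling.walk f (compatible f lines) D
  ... | w , Ss , eq , W , _
    with backward (Walk-transpose W)
           (Fits-map transposeBox (Fits-unmap rowOf w (subst (λ b → Fits b hs _) (sym eq) (path-fits D))))
  ... | g , bs , eq′ , fill , u
    with Reading.read-fill (OfFilling.entries g) 0 (height hs 0) fill
           (subst (λ n → map rowOf bs ≡ seg _ 0 n) eq′ (Ups-into-empty u (λ _ → refl)))
           (λ i y → cong (λ x → entry g (x , y)) (+-identityʳ i))
  ... | path≡ , incoming = g , dual lines (compatible⇒lines g compat) W eq path≡
    where
    compat : OfFilling.Compatible g
    compat c y = subst (λ x → entry g (x , y) ≡ true → Reading.Incoming (OfFilling.entries g) x y)
                       (+-identityʳ c) (incoming c y)

  -- The labels of `g` fix the transposed walk, hence the walk and the boundary labels of `f`, hence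
  -- `f`.
  Dual-injective : ∀ {f f′ g : Filling hs} → Dual f g → Dual f′ g → f ≡ f′
  Dual-injective {f} {f′} {g} d d′
    with Walk-functional (Walk-transpose (walk d)) (Walk-transpose (walk d′))
           (trans (pathʳ d) (sym (pathʳ d′)))
  ... | steps≡ , _ = entry-ext f f′ λ i y i<m y<h →
    subst (λ x → entry f (x , y) ≡ entry f′ (x , y)) (+-identityʳ i)
      (proj₂ (Comparison.path-injective (OfFilling.local f (compatible f (linesˡ d)))
                                        (OfFilling.local f′ (compatible f′ (linesˡ d′)))
                                        0 (height hs 0) D boundary≡) i y i<m y<h)
    where
    boundary≡ : boundary f ≡ boundary f′
    boundary≡ = trans (sym (pathˡ d)) (trans (cong (mapB rowOf)
      (trans (sym (transpose-twice (steps d))) (trans (cong (mapB transposeBox) steps≡)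
        (transpose-twice (steps d′))))) (pathˡ d′))

  Dual-ones : ∀ {f g : Filling hs} → Dual f g → ones f ≡ ones g
  Dual-ones {f} {g} d = begin
    ones f                                             ≡⟨ OfFilling.ones-boundary f (compatible f (linesˡ d)) ⟩
    turns (boundary f)                                 ≡⟨ cong turns (pathˡ d) ⟨
    turns (mapB rowOf (steps d))                       ≡⟨ turns-map proj₁ (steps d) ⟩
    turns (steps d)                                    ≡⟨ turns-map swap (steps d) ⟨
    turns (mapB transposeBox (steps d))                ≡⟨ turns-map proj₁ (mapB transposeBox (steps d)) ⟨
    turns (mapB rowOf (mapB transposeBox (steps d)))   ≡⟨ cong turns (pathʳ d) ⟩
    turns (boundary g)                                 ≡⟨ OfFilling.ones-boundary g (compatible g (linesʳ d)) ⟨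
    ones g                                             ∎
    where open ≡-Reasoning

  Dual-best : ∀ {f g : Filling hs} → Dual f g → ∀ i → i < length hs →
    ∃₂ λ a b → Best (IsNEChain f) i a × Best (IsSEChain f) i b ×
               Best (IsNEChain g) i b × Best (IsSEChain g) i a
  Dual-best {f} {g} d i i<m
    with OfFilling.walk f (compatible f (linesˡ d)) D | OfFilling.walk g (compatible g (linesʳ d)) D
  ... | w , Ss , eq , W , corner | w′ , Ss′ , eq′ , W′ , corner′
    with Walk-functional W (walk d) (trans eq (sym (pathˡ d)))
  -- Equal labels force equal walks, so the corner partitions of `g` are the transposes of those of
  -- `f`, up to `_≈_`.
  ... | refl , _ , _ with Walk-functional W′ (Walk-transpose W) (trans eq′ (sym (pathʳ d)))
  ... | _ , _ , Ss≈ =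
    rowLen S 0 , colLen S 0 ,
    OfFilling.Best-NE f compat {S = S} (corner i i<m) ,
    OfFilling.Best-SE f compat {S = S} D i<m (corner i i<m) ,
    subst (Best (IsNEChain g) i) (rows≡ T≈ 0) (OfFilling.Best-NE g compat′ {S = T} (corner′ i i<m)) ,
    subst (Best (IsSEChain g) i) (columns≡ T≈ 0) (OfFilling.Best-SE g compat′ {S = T} D i<m (corner′ i i<m))
    where
    compat = compatible f (linesˡ d)
    compat′ = compatible g (linesʳ d)
    S T : State
    S = nth Ss i
    T = nth Ss′ i
    T≈ : T ≈ transpose S
    T≈ = subst (T ≈_) (nth-transpose Ss i) (nth-resp Ss≈ i)

  Dual-counted : ∀ {n s t} {f g : Filling hs} → 1 ≤ s → 1 ≤ t → Dual f g →
                 Counted hs n s t f → Counted hs n t s g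
  Dual-counted {f = f} {g} 1≤s 1≤t d (n≡ , _ , longest-NE , longest-SE) =
    trans (sym (Dual-ones d)) n≡ , linesʳ d ,
    LongestIs-transfer 1≤t (SE-inside f) (NE-inside g)
      (λ i i<m → let a , b , _ , p , q , _ = Dual-best d i i<m in b , p , q) longest-SE ,
    LongestIs-transfer 1≤s (NE-inside f) (SE-inside g)
      (λ i i<m → let a , b , p , _ , _ , q = Dual-best d i i<m in a , p , q) longest-NE

-- Transporting an enumeration along a relation.

module _ {A : Set} {R : A → A → Set} where

  choose : ∀ {P : A → Set} xs → (∀ {x} → x ∈ xs → P x) → (∀ x → P x → ∃ (R x)) →
           ∃ λ ys → Pointwise R xs ys
  choose []       _ _ = [] , []
  choose (x ∷ xs) p total with total x (p (here refl)) | choose xs (p ∘ there) total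
  ... | y , Rxy | ys , Rs = y ∷ ys , Rxy ∷ Rs

  Pointwise-∈ˡ : ∀ {xs ys x} → Pointwise R xs ys → x ∈ xs → ∃ λ y → y ∈ ys × R x y
  Pointwise-∈ˡ (Rxy ∷ Rs) (here refl) = _ , here refl , Rxy
  Pointwise-∈ˡ (_ ∷ Rs)   (there x∈)  with Pointwise-∈ˡ Rs x∈
  ... | y , y∈ , Rxy = y , there y∈ , Rxy

  Pointwise-∈ʳ : ∀ {xs ys y} → Pointwise R xs ys → y ∈ ys → ∃ λ x → x ∈ xs × R x y
  Pointwise-∈ʳ (Rxy ∷ Rs) (here refl) = _ , here refl , Rxy
  Pointwise-∈ʳ (_ ∷ Rs)   (there y∈)  with Pointwise-∈ʳ Rs y∈
  ... | x , x∈ , Rxy = x , there x∈ , Rxy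

  Pointwise-unique : (∀ {x x′ y} → R x y → R x′ y → x ≡ x′) → ∀ {xs ys} → Pointwise R xs ys →
                     Unique xs → Unique ys
  Pointwise-unique inj []         []       = []
  Pointwise-unique inj (Rxy ∷ Rs) (x∉ ∷ U) =
    tabulate (λ y∈ eq → let x′ , x′∈ , Rx′y = Pointwise-∈ʳ Rs y∈ in
      lookup x∉ x′∈ (inj Rxy (subst (R x′) (sym eq) Rx′y))) ∷
    Pointwise-unique inj Rs U

theorem3 : (hs : Shape) → IsFerrers hs → (n s t : ℕ) → 1 ≤ s → 1 ≤ t →
    (xs : List (Filling hs)) → Enumerates (Counted hs n s t) xs →
    ∃ λ ys → Enumerates (Counted hs n t s) ys × length ys ≡ length xs
theorem3 hs ferrers n s t 1≤s 1≤t xs (unique , enum)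
  with choose {R = Dual} xs (λ {f} → Equivalence.to (enum f))
         (λ f counted → Dual-total (Ferrers⇒Descending hs ferrers) f (proj₁ (proj₂ counted)))
... | ys , Rs = ys , (Pointwise-unique (Dual-injective D) Rs unique , λ g → mk⇔ sound complete) ,
                sym (Pointwise-length Rs)
  where
  D = Ferrers⇒Descending hs ferrers
  sound : ∀ {g} → g ∈ ys → Counted hs n t s g
  sound g∈ with Pointwise-∈ʳ Rs g∈
  ... | f , f∈ , d = Dual-counted D 1≤s 1≤t d (Equivalence.to (enum f) f∈)
  complete : ∀ {g} → Counted hs n t s g → g ∈ ys
  -- The partner `f` of `g` is listed in `xs`, and the `g′` chosen for it equals `g` because both
  -- are dual to `f`.
  complete {g} counted with Dual-total D g (proj₁ (proj₂ counted))
  ... | f , d with Pointwise-∈ˡ Rs (Equivalence.from (enum f) (Dual-counted D 1≤t 1≤s d counted))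
  ... | g′ , g′∈ , d′ = subst (_∈ ys) (Dual-injective D (Dual-sym d′) d) g′∈
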